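{- $\mathrm{PC} \not\sim \mathrm{UC}$: there is a sequence $(F_n)_{n \in \mathbb{N}}$ of clause-sets in $\mathrm{UC}$ with $n(F_n) = n$, computable in time $n^{O(1)}$, such that there is no sequence $(F'_n)_{n\in\mathbb{N}}$ of clause-sets in $\mathrm{PC}$ with $F'_n$ equivalent to $F_n$ for all $n$ and $\ell(F'_n) = n^{O(1)}$.
   Context: Literals are variables $v$ and complements $\overline{v}$; a clause is a finite set of literals without complementary pair; a clause-set is a finite set of clauses; $\bot$ is the empty clause, $\top$ the empty clause-set. $n(F)$ is the number of variables of $F$, $\ell(F)=\sum_{C\in F}|C|$, $\mathrm{lit}(F)$ the set of literals over $\mathrm{var}(F)$. A partial assignment $\varphi$ (finite set of variables to $\{0,1\}$) applied to $F$, written $\varphi*F$, removes clauses containing a literal set to $1$ and removes literals set to $0$ from remaining clauses; $\langle x \to \varepsilon\rangle$ sets literal $x$ to $\varepsilon$. $F$ is satisfiable iff $\varphi*F=\top$ for some $\varphi$. Two clause-sets are equivalent iff they have the same satisfying assignments (equivalently, the same prime implicates). Unit-clause propagation $r_1$: $r_1(F) = \{\bot\}$ if $\bot \in F$; else if $F$ contains a unit clause $\{x\}$, $r_1(F) = r_1(\langle x\to 1\rangle * F)$; else $r_1(F)=F$. A literal $x$ is forced for $F$ iff $\langle x\to 0\rangle*F$ is unsatisfiable. $\mathrm{UC}$ is the class of clause-sets $F$ such that for every partial assignment $\varphi$ with $\varphi*F$ unsatisfiable, $r_1(\varphi*F)=\{\bot\}$. $\mathrm{PC}$ is the class of clause-sets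 $F$ such that for every partial assignment $\varphi$ the clause-set $G := r_1(\varphi*F)$ has no forced literal $x$ with $x \in \mathrm{lit}(G)$. -}

module Defs where

open import Data.Nat using (ℕ; zero; suc; _+_; _*_; _^_; _≤_)
import Data.Nat.Properties as ℕP
open import Data.Nat.Binary.Base using (ℕᵇ; 2[1+_]; 1+[2_]) renaming (zero to zeroᵇ; fromℕ to toℕᵇ)
open import Data.Bool using (Bool; true; false; not; _∧_; _∨_; if_then_else_)
open import Data.Maybe using (Maybe; just; nothing)
open import Data.Fin using (Fin)
open import Data.List using (List; []; _∷_; map; filter; length; concat; deduplicate; concatMap; replicate)
open import Data.Bool.ListAction using (any)
open import Data.Nat.ListAction using (sum)
open import Data.List.Membership.Propositional using (_∈_; _∉_)
open import Data.List.Relation.Unary.All using (All)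
open import Data.List.Relation.Unary.AllPairs using (AllPairs)
open import Data.List.Relation.Unary.Unique.Propositional using (Unique)
open import Data.List.Relation.Binary.Subset.Propositional using (_⊆_)
open import Data.Product using (Σ; ∃; _×_; _,_)
open import Relation.Nullary using (¬_; Dec; yes; no)
open import Relation.Nullary.Decidable using (⌊_⌋)
open import Relation.Binary.PropositionalEquality using (_≡_; refl; cong)

data Lit : Set where
  pos : ℕ → Lit
  neg : ℕ → Lit

var : Lit → ℕ
var (pos v) = v
var (neg v) = v

compl : Lit → Lit
compl (pos v) = neg v
compl (neg v) = pos v

_≟L_ : (x y : Lit) → Dec (x ≡ y)
pos a ≟L pos b with a ℕP.≟ b
... | yes refl = yes refl
... | no a≢b  = no λ { refl → a≢b refl }
neg a ≟L neg b with a ℕP.≟ b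
... | yes refl = yes refl
... | no a≢b  = no λ { refl → a≢b refl }
pos a ≟L neg b = no λ ()
neg a ≟L pos b = no λ ()

elemL : Lit → List Lit → Bool
elemL x ys = any (λ y → ⌊ x ≟L y ⌋) ys

-- A clause is represented by a list of literals, a clause-set by a
-- list of clauses; well-formedness (below) makes these faithful
-- representations of finite sets.
Clause : Set
Clause = List Lit

ClauseSet : Set
ClauseSet = List Clause

WFClause : Clause → Set
WFClause C = Unique C × (∀ x → x ∈ C → compl x ∉ C)

WFClauseSet : ClauseSet → Set
WFClauseSet F = All WFClause F × AllPairs (λ C D → ¬ (C ⊆ D × D ⊆ C)) F

vars : ClauseSet → List ℕ
vars F = deduplicate ℕP._≟_ (map var (concat F))

nvars : ClauseSet → ℕ
nvars F = length (vars F)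

ℓ : ClauseSet → ℕ
ℓ F = sum (map length F)

-- Partial assignments, represented by the set of literals set to 1.
-- (Variable v ↦ 1 is pos v ∈ φ, v ↦ 0 is neg v ∈ φ.)

PAss : Set
PAss = List Lit

Consistent : PAss → Set
Consistent φ = ∀ x → x ∈ φ → compl x ∉ φ

apply : PAss → ClauseSet → ClauseSet
apply φ F =
  map (Data.List.filter (λ x → Data.Bool.T? (not (elemL (compl x) φ))))
      (Data.List.filter (λ C → Data.Bool.T? (not (any (λ x → elemL x φ) C))) F)
  where import Data.Bool

setTrue : Lit → PAss
setTrue x = x ∷ []

setFalse : Lit → PAss
setFalse x = compl x ∷ []

Satisfiable : ClauseSet → Set
Satisfiable F = Σ PAss λ φ → Consistent φ × apply φ F ≡ []

Unsatisfiable : ClauseSet → Set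
Unsatisfiable F = ¬ Satisfiable F

Equivalent : ClauseSet → ClauseSet → Set
Equivalent F G = ∀ φ → Consistent φ → (apply φ F ≡ [] → apply φ G ≡ [])
                                     × (apply φ G ≡ [] → apply φ F ≡ [])

hasEmpty : ClauseSet → Bool
hasEmpty F = any (λ { [] → true ; _ → false }) F

findUnit : ClauseSet → Maybe Lit
findUnit [] = nothing
findUnit ((x ∷ []) ∷ F) = just x
findUnit (_ ∷ F) = findUnit F

-- The fuel is never exhausted when started with length F, since each
-- propagation step removes the unit clause.
r₁-fuel : ℕ → ClauseSet → ClauseSet
r₁-fuel k F with hasEmpty F
... | true = [] ∷ []
... | false with findUnit F
...   | nothing = F
...   | just x with k
...     | zero  = F
...     | suc k' = r₁-fuel k' (apply (setTrue x) F)

r₁ : ClauseSet → ClauseSet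
r₁ F = r₁-fuel (length F) F

Forced : Lit → ClauseSet → Set
Forced x F = Unsatisfiable (apply (setFalse x) F)

InLit : Lit → ClauseSet → Set
InLit x F = var x ∈ vars F

UC : ClauseSet → Set
UC F = ∀ φ → Consistent φ → Unsatisfiable (apply φ F) → r₁ (apply φ F) ≡ [] ∷ []

PC : ClauseSet → Set
PC F = ∀ φ → Consistent φ → ∀ x → InLit x (r₁ (apply φ F)) → ¬ Forced x (r₁ (apply φ F))

PolyBounded : (ℕ → ℕ) → Set
PolyBounded f = Σ ℕ λ c → Σ ℕ λ k → ∀ n → f n ≤ c * n ^ k + c

-- Tape symbols: blank, the output alphabet {0,1,+,-,;} and Γ extra
-- work symbols.  The input 1ⁿ is written with the symbol b1.
data Sym (Γ : ℕ) : Set where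
  blank b0 b1 sp sn sep : Sym Γ
  extra : Fin Γ → Sym Γ

data Move : Set where
  L R S : Move

-- Q+1 states, state zero is initial; transition to nothing = halt.
record TM : Set where
  field
    Q : ℕ
    Γ : ℕ
    δ : Fin (suc Q) → Sym Γ → Maybe (Fin (suc Q)) × Sym Γ × Move

record Config (M : TM) : Set where
  constructor cfg
  field
    state : Maybe (Fin (suc (TM.Q M)))    -- nothing = halted
    left  : List (Sym (TM.Γ M))            -- reversed, nearest first
    head  : Sym (TM.Γ M)
    right : List (Sym (TM.Γ M))

private
  moveL : ∀ {Γ} → List (Sym Γ) → Sym Γ → List (Sym Γ) → List (Sym Γ) × Sym Γ × List (Sym Γ)
  moveL []       h r = [] , blank , h ∷ r
  moveL (l ∷ ls) h r = ls , l , h ∷ r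
  moveR : ∀ {Γ} → List (Sym Γ) → Sym Γ → List (Sym Γ) → List (Sym Γ) × Sym Γ × List (Sym Γ)
  moveR ls h []       = h ∷ ls , blank , []
  moveR ls h (r ∷ rs) = h ∷ ls , r , rs

step : (M : TM) → Config M → Config M
step M (cfg nothing l h r) = cfg nothing l h r
step M (cfg (just q) l h r) with TM.δ M q h
... | q' , w , L with moveL l w r
...   | l' , h' , r' = cfg q' l' h' r'
step M (cfg (just q) l h r) | q' , w , R with moveR l w r
...   | l' , h' , r' = cfg q' l' h' r'
step M (cfg (just q) l h r) | q' , w , S = cfg q' l w r

run : (M : TM) → ℕ → Config M → Config M
run M zero    c = c
run M (suc t) c = run M t (step M c)

initial : (M : TM) → ℕ → Config M
initial M zero    = cfg (just Fin.zero) [] blank []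
  where import Data.Fin as Fin
initial M (suc n) = cfg (just Fin.zero) [] b1 (replicate n b1)
  where import Data.Fin as Fin

takeNonBlank : ∀ {Γ} → List (Sym Γ) → List (Sym Γ)
takeNonBlank [] = []
takeNonBlank (blank ∷ _) = []
takeNonBlank (s ∷ ss) = s ∷ takeNonBlank ss

output : (M : TM) → Config M → List (Sym (TM.Γ M))
output M c = takeNonBlank (Config.head c ∷ Config.right c)

ComputesWithin : (M : TM) → ℕ → ℕ → List (Sym (TM.Γ M)) → Set
ComputesWithin M n t w =
  Config.state (run M t (initial M n)) ≡ nothing × output M (run M t (initial M n)) ≡ w

-- Encoding of clause-sets as words:
-- a variable in bijective binary (digits b0 = 1, b1 = 2), a literal as
-- sign symbol (sp / sn) followed by its variable, each clause
-- terminated by sep.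

encℕᵇ : ∀ {Γ} → ℕᵇ → List (Sym Γ)
encℕᵇ zeroᵇ = []
encℕᵇ 1+[2 x ] = b0 ∷ encℕᵇ x
encℕᵇ 2[1+ x ] = b1 ∷ encℕᵇ x

encLit : ∀ {Γ} → Lit → List (Sym Γ)
encLit (pos v) = sp ∷ encℕᵇ (toℕᵇ v)
encLit (neg v) = sn ∷ encℕᵇ (toℕᵇ v)

encClause : ∀ {Γ} → Clause → List (Sym Γ)
encClause [] = sep ∷ []
encClause (x ∷ C) = encLit x Data.List.++ encClause C

encClauseSet : ∀ {Γ} → ClauseSet → List (Sym Γ)
encClauseSet F = concatMap encClause F

PolyTimeComputable : (ℕ → ClauseSet) → Set
PolyTimeComputable F =
  Σ TM λ M → Σ ℕ λ c → Σ ℕ λ k →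
    ∀ n → ComputesWithin M n (c * n ^ k + c) (encClauseSet (F n))

{-# OPTIONS --safe #-}
-- Consider the Horn clauses "guard ∧ cause i → effect i" for i < m and "guard → not all effects".
-- Horn clause-sets are in UC: after unit propagation every clause has a negative literal, so all
-- remaining variables can be set to 0.  Picking cause i or effect i for every i refutes the guard,
-- so each of the 2^m selections forces ¬guard.  But setting the guard to 0 satisfies everything, so in
-- an equivalent clause-set every clause contains ¬guard.  Propagation therefore cannot get started
-- under a selection unless some clause consists of ¬guard and negated picks, and such a clause must
-- contain all the negated picks, since no proper part of a selection refutes the guard.
-- An equivalent clause-set in PC thus has at least 2^m clauses.
--
-- The variables are named such that atom k is encoded by k equal digits.  The Turing machine
-- then works like a tag system: its reading head walks over the tape, and on each letter it may append
-- a word at the end.  Reading the block of a variable appends the block that is one digit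
-- shorter, so the input 1ⁿ unfolds into the short clauses, from which a second pass copies the long one.

module Submission where

open import Defs
open import Data.Bool using (Bool; true; false; not; T; T?; if_then_else_; _∨_)
open import Data.Bool.ListAction using (any)
open import Data.Bool.Properties using (T-≡; ¬-not)
open import Data.Fin using (Fin; zero; suc; combine; remQuot)
open import Data.Fin.Patterns using (0F; 1F; 2F; 3F; 4F; 5F; 6F; 7F; 8F; 9F)
open import Data.Fin.Properties using (remQuot-combine)
open import Data.List using (List; []; _∷_; _++_; map; filter; length; concat; replicate; reverse; _ʳ++_; upTo; allFin)
open import Data.List.Properties using (length-++; length-map; length-replicate; length-reverse; length-upTo; length-ʳ++; filter-notAll; ++-assoc; ++-identityʳ; ++-ʳ++; ʳ++-ʳ++; concatMap-++; map-++; map-replicate; map-ʳ++; reverse-involutive)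
open import Data.List.Membership.Propositional using (_∈_; _∉_; find; lose)
open import Data.List.Membership.Propositional.Properties
open import Data.List.Relation.Binary.Subset.Propositional using (_⊆_)
open import Data.List.Relation.Unary.All as All using (All; []; _∷_)
open import Data.List.Relation.Unary.AllPairs using (AllPairs; []; _∷_)
import Data.List.Relation.Unary.AllPairs.Properties as AllPairs
open import Data.List.Relation.Unary.Any as Any using (here; there)
open import Data.List.Relation.Unary.Any.Properties using (any⁺; any⁻)
open import Data.List.Relation.Unary.Unique.Propositional using (Unique)
import Data.List.Relation.Unary.Unique.Propositional.Properties as Unique
open import Data.List.Relation.Unary.Unique.DecPropositional.Properties using (deduplicate-!)
open import Data.Maybe as Maybe using (Maybe; just; nothing)
open import Data.Nat using (ℕ; zero; suc; _+_; _*_; _∸_; _^_; _≤_; _<_; z≤n; s≤s; s≤s⁻¹; _≟_; NonZero)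
open import Data.Nat.Binary.Base using (ℕᵇ; zero; 2[1+_]; toℕ; fromℕ)
open import Data.Nat.Binary.Properties using (fromℕ-toℕ)
open import Data.Nat.Properties hiding (_≟_)
open import Data.Nat.Tactic.RingSolver using (solve-∀)
open import Data.Product using (Σ; ∃; _×_; _,_; proj₁; proj₂)
open import Data.Sum using (_⊎_; inj₁; inj₂)
open import Data.Unit using (tt)
open import Data.Vec using (Vec; []; _∷_; lookup; tabulate)
open import Data.Vec.Properties using (tabulate-cong; tabulate∘lookup; ∷-injectiveʳ)
open import Function using (_∘_; Equivalence)
open import Relation.Nullary using (¬_; yes; no; contradiction)
open import Relation.Nullary.Decidable using (⌊_⌋; toWitness; fromWitness)
open import Relation.Binary.PropositionalEquality

-- 2 ^ (k + 1) - 2, which is a block of k digits 2 in bijective binary.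
atom : ℕ → ℕ
atom zero    = 0
atom (suc k) = 2 * suc (atom k)

guard : ℕ
guard = 1

-- For j = 2m these are the clauses guard ∧ atom 2i → atom (2i + 1); for odd j the unpaired atom 0 gets a
-- clause of its own, which matters only for the number of variables.
shorts : ℕ → ClauseSet
shorts zero          = []
shorts (suc zero)    = (pos (atom 0) ∷ neg guard ∷ []) ∷ []
shorts (suc (suc j)) = (pos (atom (suc j)) ∷ neg (atom j) ∷ neg guard ∷ []) ∷ shorts j

long : ℕ → Clause
long zero          = neg guard ∷ []
long (suc zero)    = neg (atom 0) ∷ neg guard ∷ []
long (suc (suc j)) = neg (atom (suc j)) ∷ long j

F : ℕ → ClauseSet
F zero    = []
F (suc j) = shorts j ++ long j ∷ []

-- Membership in `apply φ G` and satisfying assignments.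

elemL⁻ : ∀ {x ys} → T (elemL x ys) → x ∈ ys
elemL⁻ {x} {ys} t = Any.map toWitness (any⁻ (λ y → ⌊ x ≟L y ⌋) ys t)

elemL⁺ : ∀ {x ys} → x ∈ ys → T (elemL x ys)
elemL⁺ {x} = any⁺ (λ y → ⌊ x ≟L y ⌋) ∘ Any.map fromWitness

T-not⁻ : ∀ {b} → T (not b) → ¬ T b
T-not⁻ {false} _ ()

T-not⁺ : ∀ {b} → ¬ T b → T (not b)
T-not⁺ {false} _ = tt
T-not⁺ {true} ¬t = ¬t tt

compl-involutive : ∀ x → compl (compl x) ≡ x
compl-involutive (pos v) = refl
compl-involutive (neg v) = refl

Hits : PAss → Clause → Set
Hits φ C = ∃ λ x → x ∈ C × x ∈ φ

Satisfies : PAss → ClauseSet → Set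
Satisfies φ G = ∀ {C} → C ∈ G → Hits φ C

private
  hit : PAss → Clause → Bool
  hit φ C = any (λ x → elemL x φ) C

  hit⁻ : ∀ {φ C} → T (hit φ C) → Hits φ C
  hit⁻ {φ} {C} t with find (any⁻ (λ x → elemL x φ) C t)
  ... | x , x∈C , tx = x , x∈C , elemL⁻ tx

  hit⁺ : ∀ {φ C} → Hits φ C → T (hit φ C)
  hit⁺ {φ} (x , x∈C , x∈φ) = any⁺ (λ x → elemL x φ) (lose x∈C (elemL⁺ x∈φ))

-- Exactly the map inside `apply`, so that `apply φ G` is by definition a `map (strip φ)` over the
-- clauses not hit by `φ`.
strip : PAss → Clause → Clause
strip φ = filter (λ x → T? (not (elemL (compl x) φ)))

∈-strip⁻ : ∀ φ {C x} → x ∈ strip φ C → x ∈ C × compl x ∉ φ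
∈-strip⁻ φ {C} x∈ with ∈-filter⁻ (λ x → T? (not (elemL (compl x) φ))) {xs = C} x∈
... | x∈C , t = x∈C , T-not⁻ t ∘ elemL⁺

∈-strip⁺ : ∀ φ {C x} → x ∈ C → compl x ∉ φ → x ∈ strip φ C
∈-strip⁺ φ x∈C ∉φ = ∈-filter⁺ (λ x → T? (not (elemL (compl x) φ))) x∈C (T-not⁺ (∉φ ∘ elemL⁻))

∈-apply⁻ : ∀ φ G {D} → D ∈ apply φ G → ∃ λ C → C ∈ G × ¬ Hits φ C × D ≡ strip φ C
∈-apply⁻ φ G D∈ with ∈-map⁻ (strip φ) D∈
... | C , C∈ , eq with ∈-filter⁻ (λ C → T? (not (hit φ C))) {xs = G} C∈
...   | C∈G , t = C , C∈G , T-not⁻ t ∘ hit⁺ , eq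

∈-apply⁺ : ∀ φ {G C} → C ∈ G → ¬ Hits φ C → strip φ C ∈ apply φ G
∈-apply⁺ φ C∈G ¬hit = ∈-map⁺ (strip φ) (∈-filter⁺ (λ C → T? (not (hit φ C))) C∈G (T-not⁺ (¬hit ∘ hit⁻)))

hits? : ∀ φ C → Hits φ C ⊎ ¬ Hits φ C
hits? φ C with T? (hit φ C)
... | yes t = inj₁ (hit⁻ t)
... | no ¬t = inj₂ (¬t ∘ hit⁺)

apply≡[]⇒Satisfies : ∀ φ G → apply φ G ≡ [] → Satisfies φ G
apply≡[]⇒Satisfies φ G eq {C} C∈G with hits? φ C
... | inj₁ h = h
... | inj₂ ¬h with () ← subst (strip φ C ∈_) eq (∈-apply⁺ φ C∈G ¬h)

Satisfies⇒apply≡[] : ∀ φ G → Satisfies φ G → apply φ G ≡ []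
Satisfies⇒apply≡[] φ G sat with apply φ G in eq
... | []    = refl
... | D ∷ _ with ∈-apply⁻ φ G (subst (D ∈_) (sym eq) (here refl))
...   | C , C∈G , ¬h , _ = contradiction (sat C∈G) ¬h

-- Unit propagation and Horn clause-sets

hasEmpty⇒∈ : ∀ G → hasEmpty G ≡ true → [] ∈ G
hasEmpty⇒∈ ([] ∷ G)      eq = here refl
hasEmpty⇒∈ ((_ ∷ _) ∷ G) eq = there (hasEmpty⇒∈ G eq)

findUnit⇒∈ : ∀ G {x} → findUnit G ≡ just x → (x ∷ []) ∈ G
findUnit⇒∈ ([] ∷ G)          eq   = there (findUnit⇒∈ G eq)
findUnit⇒∈ ((x ∷ []) ∷ G)    refl = here refl
findUnit⇒∈ ((_ ∷ _ ∷ _) ∷ G) eq   = there (findUnit⇒∈ G eq)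

binary : ∀ G → hasEmpty G ≡ false → findUnit G ≡ nothing →
  All (λ C → ∃ λ x → ∃ λ y → ∃ λ D → C ≡ x ∷ y ∷ D) G
binary []                e u = []
binary ((x ∷ y ∷ D) ∷ G) e u = (x , y , D , refl) ∷ binary G e u

r₁-fixed : ∀ k G → hasEmpty G ≡ false → findUnit G ≡ nothing → r₁-fuel k G ≡ G
r₁-fixed k G e u with hasEmpty G
... | false with findUnit G
...   | nothing = refl

data Negative : Lit → Set where
  negative : ∀ {v} → Negative (neg v)

-- Positive literals can only stand at the front.
Horn : Clause → Set
Horn = AllPairs (λ _ y → Negative y)

apply-Horn : ∀ φ {G} → All Horn G → All Horn (apply φ G)
apply-Horn φ {G} horn = All.tabulate λ D∈ → lemma (∈-apply⁻ φ G D∈)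
  where
  lemma : ∀ {D} → (∃ λ C → C ∈ G × ¬ Hits φ C × D ≡ strip φ C) → Horn D
  lemma (C , C∈G , _ , refl) = AllPairs.filter⁺ _ (All.lookup horn C∈G)

-- Each clause has a second literal, which the Horn condition makes negative, so setting all
-- variables to 0 works.
binary-Horn-satisfiable : ∀ {G} → All Horn G → All (λ C → ∃ λ x → ∃ λ y → ∃ λ D → C ≡ x ∷ y ∷ D) G →
  Satisfiable G
binary-Horn-satisfiable {G} horn bin = ψ , consistent , Satisfies⇒apply≡[] ψ G sat
  where
  ψ : PAss
  ψ = map (neg ∘ var) (concat G)
  consistent : Consistent ψ
  consistent x x∈ x̄∈ with ∈-map⁻ (neg ∘ var) x∈ | ∈-map⁻ (neg ∘ var) x̄∈
  ... | _ , _ , refl | _ , _ , ()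
  sat : Satisfies ψ G
  sat C∈G with All.lookup bin C∈G | All.lookup horn C∈G
  ... | x , neg v , D , refl | (negative ∷ _) ∷ _ =
    neg v , there (here refl) , ∈-map⁺ (neg ∘ var) (∈-concat⁺′ (there (here refl)) C∈G)

-- The assignment is overridden to make `x` true. A clause that `x` does not hit was satisfied after
-- `compl x` had been stripped from it, hence by a literal that the override keeps.
satisfiable-lift : ∀ x G → Satisfiable (apply (setTrue x) G) → Satisfiable G
satisfiable-lift x G (φ , consistent , eq) = ψ , consistent′ , Satisfies⇒apply≡[] ψ G sat
  where
  rest : PAss
  -- `strip` is applied to an assignment here: it deletes `compl x` from `φ`.
  rest = strip (x ∷ []) φ
  ψ : PAss
  ψ = x ∷ rest
  rest⁻ : ∀ {y} → y ∈ rest → y ∈ φ × compl y ∉ x ∷ []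
  rest⁻ = ∈-strip⁻ (x ∷ []) {φ}
  compl≢ : ∀ x → compl x ≢ x
  compl≢ (pos v) ()
  compl≢ (neg v) ()
  consistent′ : Consistent ψ
  consistent′ y (here refl) (here eq)  = compl≢ y eq
  consistent′ y (here refl) (there p)  = proj₂ (rest⁻ p) (here (compl-involutive x))
  consistent′ y (there p)   (here eq)  = proj₂ (rest⁻ p) (here eq)
  consistent′ y (there p)   (there q)  = consistent y (proj₁ (rest⁻ p)) (proj₁ (rest⁻ q))
  sat : Satisfies ψ G
  sat {C} C∈G with hits? (x ∷ []) C
  ... | inj₁ (y , y∈C , here refl) = y , y∈C , here refl
  ... | inj₂ ¬h with apply≡[]⇒Satisfies φ _ eq (∈-apply⁺ (x ∷ []) C∈G ¬h)
  ...   | y , y∈ , y∈φ with ∈-strip⁻ (x ∷ []) y∈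
  ...     | y∈C , ∉x = y , y∈C , there (∈-strip⁺ (x ∷ []) y∈φ ∉x)

-- The unit clause itself disappears, which is why the number of clauses is enough fuel.
length-apply-unit : ∀ {x G} → (x ∷ []) ∈ G → length (apply (setTrue x) G) < length G
length-apply-unit {x} {G} u∈G rewrite length-map (strip (x ∷ [])) (filter (λ C → T? (not (hit (x ∷ []) C))) G) =
  filter-notAll (λ C → T? (not (hit (x ∷ []) C))) G
    (lose {P = λ C → ¬ T (not (hit (x ∷ []) C))} u∈G λ t → T-not⁻ t (hit⁺ {x ∷ []} {x ∷ []} (x , here refl , here refl)))

-- A propagation step preserves both the Horn property and unsatisfiability. It cannot get stuck,
-- because without an empty or unit clause the set would be satisfiable.
r₁-Horn : ∀ k G → length G ≤ k → All Horn G → Unsatisfiable G → r₁-fuel k G ≡ [] ∷ []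
r₁-Horn k G len horn unsat with hasEmpty G in e
... | true  = refl
... | false with findUnit G in u
...   | nothing = contradiction (binary-Horn-satisfiable horn (binary G e u)) unsat
r₁-Horn zero    [] len horn unsat | false | just x with () ← u
r₁-Horn (suc k) G len horn unsat | false | just x =
  r₁-Horn k (apply (setTrue x) G) (s≤s⁻¹ (≤-trans (length-apply-unit (findUnit⇒∈ G u)) len))
    (apply-Horn (setTrue x) horn) (unsat ∘ satisfiable-lift x G)

Horn⇒UC : ∀ {G} → All Horn G → UC G
Horn⇒UC {G} horn φ _ unsat = r₁-Horn _ (apply φ G) ≤-refl (apply-Horn φ horn) unsat

-- Total assignments

Holds : (ℕ → Bool) → Lit → Set
Holds β (pos v) = β v ≡ true
Holds β (neg v) = β v ≡ false

Model : (ℕ → Bool) → ClauseSet → Set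
Model β G = ∀ {C} → C ∈ G → ∃ λ x → x ∈ C × Holds β x

literal : (ℕ → Bool) → ℕ → Lit
literal β v = if β v then pos v else neg v

literal-holds : ∀ β v → Holds β (literal β v)
literal-holds β v with β v in eq
... | true  = eq
... | false = eq

holds-literal : ∀ β x → Holds β x → literal β (var x) ≡ x
holds-literal β (pos v) eq rewrite eq = refl
holds-literal β (neg v) eq rewrite eq = refl

holds-compl : ∀ β x → Holds β x → ¬ Holds β (compl x)
holds-compl β (pos v) t f with () ← trans (sym t) f
holds-compl β (neg v) f t with () ← trans (sym t) f

Model-transfer : ∀ {G H} → Equivalent G H → ∀ {β} → Model β G → Model β H
Model-transfer {G} {H} G∼H {β} model {C} C∈H =
  let x , x∈C , x∈ψ = apply≡[]⇒Satisfies ψ H (proj₁ (G∼H ψ consistent) (Satisfies⇒apply≡[] ψ G sat)) C∈H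
  in x , x∈C , holds x∈ψ
  where
  ψ : PAss
  ψ = map (literal β) (map var (concat G))
  holds : ∀ {x} → x ∈ ψ → Holds β x
  holds x∈ψ with ∈-map⁻ (literal β) x∈ψ
  ... | v , _ , refl = literal-holds β v
  consistent : Consistent ψ
  consistent x x∈ x̄∈ = holds-compl β x (holds x∈) (holds x̄∈)
  sat : Satisfies ψ G
  sat C∈G with model C∈G
  ... | x , x∈C , hx = x , x∈C ,
    subst (_∈ ψ) (holds-literal β x hx) (∈-map⁺ (literal β) (∈-map⁺ var (∈-concat⁺′ x∈C C∈G)))

Equivalent-sym : ∀ {G H} → Equivalent G H → Equivalent H G
Equivalent-sym G∼H φ c = proj₂ (G∼H φ c) , proj₁ (G∼H φ c)

-- Counting

⊆-length : ∀ {A : Set} {xs ys : List A} → Unique xs → xs ⊆ ys → length xs ≤ length ys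
⊆-length {xs = []}     _            _  = z≤n
⊆-length {A} {x ∷ xs} (x∉ ∷ xs!) xs⊆ with ∈-∃++ (xs⊆ (here refl))
... | as , bs , refl = ≤-trans (s≤s (⊆-length xs! sub))
    (≤-reflexive (trans (cong suc (length-++ as)) (trans (sym (+-suc (length as) _)) (sym (length-++ as)))))
  where
  sub : xs ⊆ as ++ bs
  sub {y} y∈ with ∈-++⁻ as (xs⊆ (there y∈))
  ... | inj₁ p            = ∈-++⁺ˡ p
  ... | inj₂ (here refl)  = contradiction refl (All.lookup x∉ y∈)
  ... | inj₂ (there p)    = ∈-++⁺ʳ as p

unique-length : ∀ {A : Set} {xs ys : List A} → Unique xs → Unique ys → xs ⊆ ys → ys ⊆ xs → length xs ≡ length ys
unique-length xs! ys! xs⊆ ys⊆ = ≤-antisym (⊆-length xs! xs⊆) (⊆-length ys! ys⊆)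

-- The clause-sets F are Horn

atom-injective : ∀ {i j} → atom i ≡ atom j → i ≡ j
atom-injective {zero}  {zero}  _  = refl
atom-injective {suc i} {suc j} eq = cong suc (atom-injective (suc-injective (*-cancelˡ-≡ _ _ 2 eq)))

-- Atoms are even and the guard is 1.
atom≢guard : ∀ k → atom k ≢ guard
atom≢guard (suc k) eq = even≢odd (suc (atom k)) 0 eq

long⁻ : ∀ j {x} → x ∈ long j → x ≡ neg guard ⊎ ∃ λ k → k < j × x ≡ neg (atom k)
long⁻ zero          (here eq)         = inj₁ eq
long⁻ (suc zero)    (here eq)         = inj₂ (0 , s≤s z≤n , eq)
long⁻ (suc zero)    (there (here eq)) = inj₁ eq
long⁻ (suc (suc j)) (here eq)         = inj₂ (suc j , ≤-refl , eq)
long⁻ (suc (suc j)) (there x∈) with long⁻ j x∈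
... | inj₁ eq            = inj₁ eq
... | inj₂ (k , k<j , eq) = inj₂ (k , m≤n⇒m≤1+n (m≤n⇒m≤1+n k<j) , eq)

-- Records the shape of a clause and a bound on its index, forgetting which indices occur for the
-- parity of `j`.
data Short (j : ℕ) : Clause → Set where
  last : j ≢ 0 → Short j (pos (atom 0) ∷ neg guard ∷ [])
  pair : ∀ k → suc k < j → Short j (pos (atom (suc k)) ∷ neg (atom k) ∷ neg guard ∷ [])

shorts⁻ : ∀ j {C} → C ∈ shorts j → Short j C
shorts⁻ (suc zero)    (here refl) = last λ ()
shorts⁻ (suc (suc j)) (here refl) = pair j ≤-refl
shorts⁻ (suc (suc j)) (there C∈) with shorts⁻ j C∈
... | last _   = last λ ()
... | pair k k<j = pair k (m≤n⇒m≤1+n (m≤n⇒m≤1+n k<j))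

data In-F (j : ℕ) : Clause → Set where
  isShort : ∀ {C} → Short j C → In-F j C
  isLong  : In-F j (long j)

F⁻ : ∀ j {C} → C ∈ F (suc j) → In-F j C
F⁻ j C∈ with ∈-++⁻ (shorts j) C∈
... | inj₁ p           = isShort (shorts⁻ j p)
... | inj₂ (here refl) = isLong

guard∈long : ∀ j → neg guard ∈ long j
guard∈long zero          = here refl
guard∈long (suc zero)    = there (here refl)
guard∈long (suc (suc j)) = there (guard∈long j)

guard∈F : ∀ j {C} → C ∈ F (suc j) → neg guard ∈ C
guard∈F j C∈ with F⁻ j C∈
... | isShort (last _)   = there (here refl)
... | isShort (pair _ _) = there (there (here refl))
... | isLong           = guard∈long j

all-negative : ∀ {C} → (∀ {x} → x ∈ C → Negative x) → Horn C
all-negative {[]}    _   = []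
all-negative {x ∷ C} C⁻ = All.tabulate (C⁻ ∘ there) ∷ all-negative (C⁻ ∘ there)

long-negative : ∀ j {x} → x ∈ long j → Negative x
long-negative j x∈ with long⁻ j x∈
... | inj₁ refl           = negative
... | inj₂ (_ , _ , refl) = negative

F-Horn : ∀ n → All Horn (F n)
F-Horn zero    = []
F-Horn (suc j) = All.tabulate λ C∈ → horn (F⁻ j C∈)
  where
  horn : ∀ {C} → In-F j C → Horn C
  horn (isShort (last _))   = (negative ∷ []) ∷ [] ∷ []
  horn (isShort (pair _ _)) = (negative ∷ negative ∷ []) ∷ (negative ∷ []) ∷ [] ∷ []
  horn isLong             = all-negative (long-negative j)

-- Well-formedness and the number of variables.

neg-injective : ∀ {u v} → neg u ≡ neg v → u ≡ v
neg-injective refl = refl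

long-unique : ∀ j → Unique (long j)
long-unique zero          = [] ∷ []
long-unique (suc zero)    = ((λ ()) ∷ []) ∷ [] ∷ []
long-unique (suc (suc j)) = All.tabulate fresh ∷ long-unique j
  where
  fresh : ∀ {x} → x ∈ long j → neg (atom (suc j)) ≢ x
  fresh x∈ refl with long⁻ j x∈
  ... | inj₁ eq = atom≢guard (suc j) (neg-injective eq)
  ... | inj₂ (k , k<j , eq) = <⇒≢ (m≤n⇒m≤1+n k<j) (sym (atom-injective (neg-injective eq)))

F-clauses : ∀ j {C} → In-F j C → WFClause C
F-clauses j (isShort (last _)) = (((λ ()) ∷ []) ∷ [] ∷ []) , λ
  { _ (here refl)         (there (here ()))
  ; _ (there (here refl)) (here ())
  ; _ (there (here refl)) (there (here ())) }
F-clauses j (isShort (pair k _)) =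
  (((λ ()) ∷ (λ ()) ∷ []) ∷ ((atom≢guard k ∘ neg-injective) ∷ []) ∷ [] ∷ []) , λ
  { _ (here refl)                 (here ())
  ; _ (here refl)                 (there (here eq))          → different (neg-injective eq)
  ; _ (here refl)                 (there (there (here eq)))  → atom≢guard (suc k) (neg-injective eq)
  ; _ (there (here refl))         (here eq)                  → different (sym (pos-injective eq))
  ; _ (there (here refl))         (there (here ()))
  ; _ (there (here refl))         (there (there (here ())))
  ; _ (there (there (here refl))) (here eq)                  → atom≢guard (suc k) (sym (pos-injective eq))
  ; _ (there (there (here refl))) (there (here ()))
  ; _ (there (there (here refl))) (there (there (here ()))) }
  where
  pos-injective : ∀ {u v} → pos u ≡ pos v → u ≡ v
  pos-injective refl = refl
  different : atom (suc k) ≢ atom k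
  different eq with atom-injective {suc k} {k} eq
  ... | ()
F-clauses j isLong = long-unique j , λ x x∈ x̄∈ → clash (long-negative j x∈) (long-negative j x̄∈)
  where
  clash : ∀ {x} → Negative x → ¬ Negative (compl x)
  clash negative ()

-- Distinct clauses of F differ in their positive literals.
F-distinct : ∀ j → AllPairs (λ C D → ¬ (C ⊆ D × D ⊆ C)) (F (suc j))
F-distinct j = distinct j (long-negative j)
  where
  -- The last clause is an arbitrary negative `D`, because the induction shortens `shorts i` while
  -- the long clause stays the same.
  distinct : ∀ i {D} → (∀ {x} → x ∈ D → Negative x) → AllPairs (λ C D → ¬ (C ⊆ D × D ⊆ C)) (shorts i ++ D ∷ [])
  apart : ∀ i {C D v} → (∀ {x} → x ∈ D → Negative x) → C ∈ shorts i ++ D ∷ [] →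
    (∀ k → k < i → v ≢ atom k) → pos v ∉ C
  apart i D-neg C∈ v-new p with ∈-++⁻ (shorts i) C∈
  ... | inj₂ (here refl) with () ← D-neg p
  ... | inj₁ C∈′ with shorts⁻ i C∈′ | p
  ...   | last i≢0   | here refl = v-new 0 (n≢0⇒n>0 i≢0) refl
  ...   | pair k k<i | here refl = v-new (suc k) k<i refl
  ...   | last i≢0   | there (here ())
  ...   | pair k k<i | there (there (here ()))
  distinct zero          D-neg = [] ∷ []
  distinct (suc zero)    D-neg = All.tabulate (λ C∈ (sub , _) → apart 0 D-neg C∈ (λ _ ()) (sub (here refl))) ∷ [] ∷ []
  distinct (suc (suc i)) D-neg =
    -- The head `atom (suc i)` lies above all atoms of the later short clauses, and `D` has no
    -- positive literal.
    All.tabulate (λ C∈ (sub , _) →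
      apart i D-neg C∈ (λ k k<i eq → <⇒≢ (m≤n⇒m≤1+n k<i) (sym (atom-injective {suc i} {k} eq))) (sub (here refl)))
    ∷ distinct i D-neg

F-WF : ∀ n → WFClauseSet (F n)
F-WF zero    = [] , []
F-WF (suc j) = All.tabulate (λ C∈ → F-clauses j (F⁻ j C∈)) , F-distinct j

-- The variables are the guard and the first `j` atoms; duplicate-free lists with the same elements
-- have the same length.
F-nvars : ∀ n → nvars (F n) ≡ n
F-nvars zero    = refl
F-nvars (suc j) = trans
  (unique-length (deduplicate-! _≟_ occurring) expected-unique
    (λ v∈ → occurring⊆ (∈-deduplicate⁻ _≟_ occurring v∈)) (λ v∈ → ∈-deduplicate⁺ _≟_ (expected⊆ v∈)))
  (cong suc (trans (length-map atom (upTo j)) (length-upTo j)))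
  where
  occurring expected : List ℕ
  occurring = map var (concat (F (suc j)))
  expected = guard ∷ map atom (upTo j)

  expected-unique : Unique expected
  expected-unique = All.tabulate (λ v∈ eq → let k , _ , eq′ = ∈-map⁻ atom v∈ in atom≢guard k (sym (trans eq eq′)))
    ∷ Unique.map⁺ atom-injective (Unique.upTo⁺ j)

  atom∈ : ∀ {k} → k < j → atom k ∈ expected
  atom∈ k<j = there (∈-map⁺ atom (∈-upTo⁺ k<j))

  literal⊆ : ∀ {C x} → In-F j C → x ∈ C → var x ∈ expected
  literal⊆ (isShort (last j≢0))   (here refl)                 = atom∈ (n≢0⇒n>0 j≢0)
  literal⊆ (isShort (last j≢0))   (there (here refl))         = here refl
  literal⊆ (isShort (pair k k<j)) (here refl)                 = atom∈ k<j
  literal⊆ (isShort (pair k k<j)) (there (here refl))         = atom∈ (<-trans ≤-refl k<j)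
  literal⊆ (isShort (pair k k<j)) (there (there (here refl))) = here refl
  literal⊆ isLong x∈ with long⁻ j x∈
  ... | inj₁ refl             = here refl
  ... | inj₂ (k , k<j , refl) = atom∈ k<j

  occurring⊆ : occurring ⊆ expected
  occurring⊆ v∈ with ∈-map⁻ var v∈
  ... | x , x∈ , refl with ∈-concat⁻′ (F (suc j)) x∈
  ...   | C , x∈C , C∈F = literal⊆ (F⁻ j C∈F) x∈C

  in-shorts : ∀ i {k} → k < i → atom k ∈ map var (concat (shorts i))
  in-shorts (suc zero)    (s≤s z≤n) = here refl
  in-shorts (suc (suc i)) {k} (s≤s k≤) with m≤n⇒m<n∨m≡n k≤
  ... | inj₂ refl = here refl
  ... | inj₁ (s≤s k≤i) with m≤n⇒m<n∨m≡n k≤i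
  ...   | inj₂ refl = there (here refl)
  ...   | inj₁ k<i  = there (there (there (in-shorts i k<i)))

  expected⊆ : expected ⊆ occurring
  expected⊆ (here refl) = ∈-map⁺ var (∈-concat⁺′ (guard∈long j) (∈-++⁺ʳ (shorts j) (here refl)))
  expected⊆ (there v∈) with ∈-map⁻ atom v∈
  ... | k , k∈ , refl with ∈-map⁻ var (in-shorts j (∈-upTo⁻ k∈))
  ...   | x , x∈ , eq with ∈-concat⁻′ (shorts j) x∈
  ...     | C , x∈C , C∈ = subst (_∈ occurring) (sym eq) (∈-map⁺ var (∈-concat⁺′ x∈C (∈-++⁺ˡ C∈)))

-- Lower bound

-- Matches the recursion of `shorts` and `long` by twos, so that one successor of `m` unfolds
-- exactly one rule.
double : ℕ → ℕ
double zero    = zero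
double (suc m) = suc (suc (double m))

double-injective : ∀ {i j} → double i ≡ double j → i ≡ j
double-injective {zero}  {zero}  _  = refl
double-injective {suc i} {suc j} eq = cong suc (double-injective (suc-injective (suc-injective eq)))

double≢suc-double : ∀ i j → double i ≢ suc (double j)
double≢suc-double (suc i) (suc j) eq = double≢suc-double i j (suc-injective (suc-injective eq))

-- Counts from the end, as shorts and long start with the highest variable.
rank : ∀ {m} → Fin m → ℕ
rank {suc m} zero    = m
rank {suc m} (suc i) = rank i

rank< : ∀ {m} (i : Fin m) → rank i < m
rank< {suc m} zero    = ≤-refl
rank< {suc m} (suc i) = m≤n⇒m≤1+n (rank< i)

rank-injective : ∀ {m} {i j : Fin m} → rank i ≡ rank j → i ≡ j
rank-injective {suc m} {zero}  {zero}  _  = refl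
rank-injective {suc m} {zero}  {suc j} eq = contradiction (rank< j) (<-irrefl (sym eq))
rank-injective {suc m} {suc i} {zero}  eq = contradiction (rank< i) (<-irrefl eq)
rank-injective {suc m} {suc i} {suc j} eq = cong suc (rank-injective eq)

cause effect : ∀ {m} → Fin m → ℕ
cause  i = atom (double (rank i))
effect i = atom (suc (double (rank i)))

cause-injective : ∀ {m} {i j : Fin m} → cause i ≡ cause j → i ≡ j
cause-injective = rank-injective ∘ double-injective ∘ atom-injective

effect-injective : ∀ {m} {i j : Fin m} → effect i ≡ effect j → i ≡ j
effect-injective eq = rank-injective (double-injective (suc-injective (atom-injective eq)))

cause≢effect : ∀ {m} (i j : Fin m) → cause i ≢ effect j
cause≢effect i j = double≢suc-double (rank i) (rank j) ∘ atom-injective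

rule : ∀ {m} → Fin m → Clause
rule i = pos (effect i) ∷ neg (cause i) ∷ neg guard ∷ []

shorts-double⁻ : ∀ m {C} → C ∈ shorts (double m) → ∃ λ (i : Fin m) → C ≡ rule i
shorts-double⁻ (suc m) (here eq) = zero , eq
shorts-double⁻ (suc m) (there C∈) with shorts-double⁻ m C∈
... | i , eq = suc i , eq

shorts-double⁺ : ∀ m (i : Fin m) → rule i ∈ shorts (double m)
shorts-double⁺ (suc m) zero    = here refl
shorts-double⁺ (suc m) (suc i) = there (shorts-double⁺ m i)

long-double⁻ : ∀ m {x} → x ∈ long (double m) → x ≡ neg guard ⊎ ∃ λ (i : Fin m) → x ≡ neg (effect i)
long-double⁻ zero    (here eq) = inj₁ eq
long-double⁻ (suc m) (here eq) = inj₂ (zero , eq)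
long-double⁻ (suc m) (there x∈) with long-double⁻ m x∈
... | inj₁ eq       = inj₁ eq
... | inj₂ (i , eq) = inj₂ (suc i , eq)

long-double⁺ : ∀ m (i : Fin m) → neg (effect i) ∈ long (double m)
long-double⁺ (suc m) zero    = here refl
long-double⁺ (suc m) (suc i) = there (long-double⁺ m i)

pick : ∀ {m} → Vec Bool m → Fin m → Lit
pick σ i = if lookup σ i then pos (cause i) else pos (effect i)

picks : ∀ {m} → Vec Bool m → PAss
picks {m} σ = map (pick σ) (allFin m)

data Picked {m} (σ : Vec Bool m) (i : Fin m) : Lit → Set where
  cause-picked  : lookup σ i ≡ true  → Picked σ i (pos (cause i))
  effect-picked : lookup σ i ≡ false → Picked σ i (pos (effect i))

picked : ∀ {m} (σ : Vec Bool m) i → Picked σ i (pick σ i)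
picked σ i with lookup σ i in eq
... | true  = cause-picked eq
... | false = effect-picked eq

picks⁻ : ∀ {m} {σ : Vec Bool m} {x} → x ∈ picks σ → ∃ λ i → Picked σ i x
picks⁻ {σ = σ} x∈ with ∈-map⁻ (pick σ) x∈
... | i , _ , refl = i , picked σ i

pick∈picks : ∀ {m} (σ : Vec Bool m) i → pick σ i ∈ picks σ
pick∈picks σ i = ∈-map⁺ (pick σ) (∈-allFin i)

picks-positive : ∀ {m} {σ : Vec Bool m} {v} → neg v ∉ picks σ
picks-positive {σ = σ} {v} n∈ with picks⁻ {σ = σ} n∈
... | i , ()

guard∉picks : ∀ {m} {σ : Vec Bool m} → pos guard ∉ picks σ
guard∉picks {σ = σ} g∈ = lemma (picks⁻ {σ = σ} g∈) refl
  where
  lemma : ∀ {v} → (∃ λ i → Picked σ i (pos v)) → v ≢ guard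
  lemma (i , cause-picked _)  = atom≢guard (double (rank i))
  lemma (i , effect-picked _) = atom≢guard (suc (double (rank i)))

picks-consistent : ∀ {m} (σ : Vec Bool m) → Consistent (picks σ)
picks-consistent σ (pos v) _  n∈ = picks-positive {σ = σ} n∈
picks-consistent σ (neg v) n∈ _  = picks-positive {σ = σ} n∈

positives : PAss → ℕ → Bool
positives φ v = elemL (pos v) φ

positives-true : ∀ {φ v} → pos v ∈ φ → positives φ v ≡ true
positives-true {φ} {v} p = Equivalence.to T-≡ (elemL⁺ p)

positives-false : ∀ {φ v} → pos v ∉ φ → positives φ v ≡ false
positives-false {φ} {v} p = ¬-not (p ∘ elemL⁻ ∘ Equivalence.from T-≡)

-- Once the guard holds, each picked literal yields the effect of its pair, against the long clause.
picks-refute : ∀ {m} (σ : Vec Bool m) {β} → β guard ≡ true → (∀ i → Holds β (pick σ i)) →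
  ¬ Model β (F (suc (double m)))
picks-refute {m} σ {β} g hold model with model (∈-++⁺ʳ (shorts (double m)) (here refl))
... | x , x∈ , hx with long-double⁻ m x∈
...   | inj₁ refl       = holds-compl β (neg guard) hx g
...   | inj₂ (i , refl) = holds-compl β (neg (effect i)) hx (effect-holds (picked σ i) (hold i))
  where
  effect-holds : ∀ {i x} → Picked σ i x → Holds β x → β (effect i) ≡ true
  effect-holds         (effect-picked _) h = h
  effect-holds {i = i} (cause-picked _)  h with model (∈-++⁺ˡ (shorts-double⁺ m i))
  ... | _ , here refl , e                 = e
  ... | _ , there (here refl) , c         = contradiction h (holds-compl β (neg (cause i)) c)
  ... | _ , there (there (here refl)) , n = contradiction g (holds-compl β (neg guard) n)

-- The assignment dropping i refutes an implicate all of whose literals are ¬guard or negated picks for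
-- pairs other than i.
module _ {m : ℕ} (i : Fin m) where

  dropping : ℕ → Bool
  dropping v = not (⌊ v ≟ cause i ⌋ ∨ ⌊ v ≟ effect i ⌋)

  dropping-cause : dropping (cause i) ≡ false
  dropping-cause with cause i ≟ cause i
  ... | yes _ = refl
  ... | no ¬p = contradiction refl ¬p

  dropping-effect : dropping (effect i) ≡ false
  dropping-effect with effect i ≟ cause i | effect i ≟ effect i
  ... | yes _ | _     = refl
  ... | no _  | yes _ = refl
  ... | no _  | no ¬p = contradiction refl ¬p

  dropping-other : ∀ {v} → v ≢ cause i → v ≢ effect i → dropping v ≡ true
  dropping-other {v} ≢c ≢e with v ≟ cause i | v ≟ effect i
  ... | yes p | _     = contradiction p ≢c
  ... | no _  | yes p = contradiction p ≢e
  ... | no _  | no _  = refl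

  dropping-only : ∀ {v} → dropping v ≢ true → v ≡ cause i ⊎ v ≡ effect i
  dropping-only {v} ¬t with v ≟ cause i | v ≟ effect i
  ... | yes p | _     = inj₁ p
  ... | no _  | yes p = inj₂ p
  ... | no _  | no _  = contradiction refl ¬t

  dropping-guard : dropping guard ≡ true
  dropping-guard = dropping-other (atom≢guard (double (rank i)) ∘ sym) (atom≢guard (suc (double (rank i))) ∘ sym)

  -- The long clause holds by the negated effect of `i`, rule `i` by its negated cause, and any
  -- other rule by its effect.
  dropping-model : Model dropping (F (suc (double m)))
  dropping-model C∈ with ∈-++⁻ (shorts (double m)) C∈
  ... | inj₂ (here refl) = neg (effect i) , long-double⁺ m i , dropping-effect
  ... | inj₁ C∈′ with shorts-double⁻ m C∈′
  ...   | k , refl with effect k ≟ effect i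
  ...     | no ≢e  = pos (effect k) , here refl , dropping-other (cause≢effect i k ∘ sym) ≢e
  ...     | yes eq with effect-injective {i = k} {i} eq
  ...       | refl = neg (cause i) , there (here refl) , dropping-cause

-- Selections and the clauses they force in an equivalent clause-set in PC.

selections : ∀ k → List (Vec Bool k)
selections zero    = [] ∷ []
selections (suc k) = map (true ∷_) (selections k) ++ map (false ∷_) (selections k)

selections-unique : ∀ k → Unique (selections k)
selections-unique zero    = [] ∷ []
selections-unique (suc k) = Unique.++⁺
  (Unique.map⁺ ∷-injectiveʳ (selections-unique k)) (Unique.map⁺ ∷-injectiveʳ (selections-unique k))
  λ { (p , q) → disjoint (∈-map⁻ (true ∷_) p) (∈-map⁻ (false ∷_) q) }
  where
  disjoint : ∀ {σ : Vec Bool (suc k)} → (∃ λ τ → τ ∈ selections k × σ ≡ true ∷ τ) →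
    ¬ (∃ λ τ → τ ∈ selections k × σ ≡ false ∷ τ)
  disjoint (_ , _ , refl) (_ , _ , ())

length-selections : ∀ k → length (selections k) ≡ 2 ^ k
length-selections zero    = refl
length-selections (suc k) = begin
  length (map (true ∷_) (selections k) ++ map (false ∷_) (selections k))
    ≡⟨ length-++ (map (true ∷_) (selections k)) ⟩
  length (map (true ∷_) (selections k)) + length (map (false ∷_) (selections k))
    ≡⟨ cong₂ _+_ (length-map _ (selections k)) (length-map _ (selections k)) ⟩
  length (selections k) + length (selections k)
    ≡⟨ cong₂ _+_ (length-selections k) (trans (length-selections k) (sym (+-identityʳ _))) ⟩
  2 ^ suc k ∎
  where open ≡-Reasoning

module _ {m : ℕ} (G : ClauseSet) (pc : PC G) (G∼F : Equivalent G (F (suc (double m)))) where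

  -- The assignment with the single literal `neg guard` satisfies `F`, hence `G`, and can hit a
  -- clause only in that literal.
  guard∈G : ∀ {C} → C ∈ G → neg guard ∈ C
  guard∈G C∈G with apply≡[]⇒Satisfies ψ G (proj₂ (G∼F ψ consistent) F-sat) C∈G
    where
    ψ : PAss
    ψ = neg guard ∷ []
    consistent : Consistent ψ
    consistent _ (here refl) (here ())
    F-sat : apply ψ (F (suc (double m))) ≡ []
    F-sat = Satisfies⇒apply≡[] ψ _ λ C∈ → neg guard , guard∈F (double m) C∈ , here refl
  ... | _ , x∈C , here refl = x∈C

  module _ (σ : Vec Bool m) where

    private
      G/σ : ClauseSet
      G/σ = apply (picks σ) G

    -- A satisfying assignment with the guard at 1 would, together with the picks, yield a model of
    -- `G` and thus of `F`, against `picks-refute`.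
    guard-forced : Forced (neg guard) G/σ
    guard-forced (ψ , consistent , eq) =
      picks-refute σ (positives-true {Φ} (here refl)) holds (Model-transfer G∼F {β} model)
      where
      Φ : PAss
      -- `ψ` may set the guard or a picked variable to 0. Since `positives` looks at positive
      -- literals only, the guard and the picks override it; clauses that `ψ` had to satisfy were
      -- already stripped of the negations of these variables.
      Φ = pos guard ∷ picks σ ++ ψ
      β : ℕ → Bool
      β = positives Φ
      in-picks : ∀ {x} → x ∈ picks σ → Holds β x
      in-picks {pos v} x∈ = positives-true {Φ} (there (∈-++⁺ˡ x∈))
      in-picks {neg v} x∈ = contradiction x∈ (picks-positive {σ = σ})
      holds : ∀ i → Holds β (pick σ i)
      holds i = in-picks (pick∈picks σ i)
      model : Model β G
      model {C} C∈G with hits? (picks σ) C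
      ... | inj₁ (x , x∈C , x∈φ) = x , x∈C , in-picks x∈φ
      ... | inj₂ ¬h with hits? (pos guard ∷ []) (strip (picks σ) C)
      ...   | inj₁ (_ , x∈ , here refl) = pos guard , proj₁ (∈-strip⁻ (picks σ) {C} x∈) , positives-true {Φ} (here refl)
      ...   | inj₂ ¬g with apply≡[]⇒Satisfies ψ _ eq (∈-apply⁺ (pos guard ∷ []) (∈-apply⁺ (picks σ) C∈G ¬h) ¬g)
      ...     | x , x∈ , x∈ψ with ∈-strip⁻ (pos guard ∷ []) {strip (picks σ) C} x∈
      ...       | x∈′ , ∉g with ∈-strip⁻ (picks σ) {C} x∈′
      ...         | x∈C , ∉φ = x , x∈C , holds-x x x∈ψ ∉g ∉φ
        where
        holds-x : ∀ x → x ∈ ψ → compl x ∉ pos guard ∷ [] → compl x ∉ picks σ → Holds β x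
        holds-x (pos v) x∈ψ _  _  = positives-true {Φ} (there (∈-++⁺ʳ (picks σ) x∈ψ))
        holds-x (neg v) x∈ψ ∉g ∉φ = positives-false {Φ} out
          where
          out : pos v ∉ Φ
          out (here eq) = ∉g (here eq)
          out (there p) with ∈-++⁻ (picks σ) p
          ... | inj₁ q = ∉φ q
          ... | inj₂ q = consistent (neg v) x∈ψ q

    -- Otherwise the forced literal `neg guard` would still occur after propagation, against `PC`.
    ¬fixed : ¬ (r₁ G/σ ≡ G/σ)
    ¬fixed eq = pc (picks σ) (picks-consistent σ) (neg guard) in-lit
        (subst (Forced (neg guard)) (sym eq) guard-forced)
      where
      -- The picks are positive and the long clause is negative, so they do not satisfy `F`, hence
      -- not `G`.
      unsatisfied : ¬ (G/σ ≡ [])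
      unsatisfied empty with apply≡[]⇒Satisfies (picks σ) _
        (proj₁ (G∼F (picks σ) (picks-consistent σ)) empty) (∈-++⁺ʳ (shorts (double m)) (here refl))
      ... | x , x∈long , x∈φ with long-negative (double m) x∈long
      ...   | negative = picks-positive {σ = σ} x∈φ
      some-clause : ∀ {H : ClauseSet} → H ≢ [] → ∃ λ D → D ∈ H
      some-clause {[]}    ne = contradiction refl ne
      some-clause {D ∷ _} ne = D , here refl
      in-lit : InLit (neg guard) (r₁ G/σ)
      in-lit with some-clause unsatisfied
      ... | D , D∈ with ∈-apply⁻ (picks σ) G D∈
      ...   | C , C∈G , _ , refl = subst (InLit (neg guard)) (sym eq)
              (∈-deduplicate⁺ _≟_ (∈-map⁺ var (∈-concat⁺′ (∈-strip⁺ (picks σ) (guard∈G C∈G) (guard∉picks {σ = σ})) D∈)))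

    -- Characterises the clauses of which `picks σ` leaves at most the literal `neg guard`.
    Witness : Clause → Set
    Witness C = ∀ {x} → x ∈ C → x ≡ neg guard ⊎ compl x ∈ picks σ

    -- `neg guard` survives in `D`, so every literal of `D` equals it. The condition on `D` covers
    -- the empty clause and unit clauses at once.
    from-small : ∀ {D} → D ∈ G/σ → (∀ {x y} → x ∈ D → y ∈ D → x ≡ y) → ∃ λ C → C ∈ G × Witness C
    from-small D∈ small with ∈-apply⁻ (picks σ) G D∈
    ... | C , C∈G , _ , refl = C , C∈G , witness
      where
      witness : Witness C
      witness {x} x∈C with T? (elemL (compl x) (picks σ))
      ... | yes t = inj₂ (elemL⁻ t)
      ... | no ¬t = inj₁ (small (∈-strip⁺ (picks σ) x∈C (¬t ∘ elemL⁺))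
                                (∈-strip⁺ (picks σ) (guard∈G C∈G) (guard∉picks {σ = σ})))

    -- Every clause of G/σ contains neg guard, so unit propagation can only start from a clause {neg guard}.
    witness : ∃ λ C → C ∈ G × Witness C
    witness with hasEmpty G/σ in e
    ... | true  = from-small (hasEmpty⇒∈ G/σ e) λ ()
    ... | false with findUnit G/σ in u
    ...   | nothing = contradiction (r₁-fixed (length G/σ) G/σ e u) ¬fixed
    ...   | just x  = from-small (findUnit⇒∈ G/σ u) λ { (here refl) (here refl) → refl }

    -- The model `dropping i` satisfies `C`, and of the literals that `Witness` allows only the
    -- negated pick for `i` is true in it.
    witness-complete : ∀ {C} → C ∈ G → Witness C → ∀ i → compl (pick σ i) ∈ C
    witness-complete {C} C∈G w i with T? (elemL (compl (pick σ i)) C)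
    ... | yes t = elemL⁻ t
    ... | no ¬t with Model-transfer (Equivalent-sym {G} {F (suc (double m))} G∼F) {dropping i} (dropping-model i) C∈G
    ...   | x , x∈C , hx with w x∈C
    ...     | inj₁ refl = contradiction (dropping-guard i) (holds-compl (dropping i) (neg guard) hx)
    ...     | inj₂ x̄∈ with ∈-map⁻ (pick σ) x̄∈
    ...       | k , _ , eq = contradiction (elemL⁺ (subst (_∈ C) x≡ x∈C)) ¬t
      where
      false-pick : ¬ Holds (dropping i) (pick σ k)
      false-pick h = holds-compl (dropping i) x hx (subst (Holds (dropping i)) (sym eq) h)
      lemma : ∀ {y} → Picked σ k y → ¬ Holds (dropping i) y → k ≡ i
      lemma (cause-picked _) ¬h with dropping-only i ¬h
      ... | inj₁ eq = cause-injective eq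
      ... | inj₂ eq = contradiction eq (cause≢effect k i)
      lemma (effect-picked _) ¬h with dropping-only i ¬h
      ... | inj₁ eq = contradiction (sym eq) (cause≢effect i k)
      ... | inj₂ eq = effect-injective {i = k} {i} eq
      x≡ : x ≡ compl (pick σ i)
      x≡ = trans (sym (compl-involutive x))
        (cong compl (trans eq (cong (pick σ) (lemma (picked σ k) false-pick))))

    -- Recovers `σ` from any of its witnesses, so that different selections cannot share one. For a
    -- false bit, the negated cause is neither `neg guard` nor a negated pick.
    selection-bit : ∀ {C} → C ∈ G → Witness C → ∀ i → elemL (neg (cause i)) C ≡ lookup σ i
    selection-bit {C} C∈G w i = lemma (picked σ i) (witness-complete C∈G w i)
      where
      not-picked : lookup σ i ≡ false → pos (cause i) ∉ picks σ
      not-picked f p = absurd (picks⁻ {σ = σ} p) refl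
        where
        absurd : ∀ {v} → (∃ λ k → Picked σ k (pos v)) → v ≢ cause i
        absurd (k , cause-picked t) eq with cause-injective {i = k} {i} eq
        ... | refl with () ← trans (sym t) f
        absurd (k , effect-picked _) eq = cause≢effect i k (sym eq)
      lemma : ∀ {x} → Picked σ i x → compl x ∈ C → elemL (neg (cause i)) C ≡ lookup σ i
      lemma (cause-picked t)  c∈ = trans (Equivalence.to T-≡ (elemL⁺ c∈)) (sym t)
      lemma (effect-picked f) _  = trans (¬-not λ t → excluded (w (elemL⁻ (Equivalence.from T-≡ t)))) (sym f)
        where
        excluded : ¬ (neg (cause i) ≡ neg guard ⊎ pos (cause i) ∈ picks σ)
        excluded (inj₁ eq) = atom≢guard (double (rank i)) (neg-injective eq)
        excluded (inj₂ p)  = not-picked f p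

  -- Decoding maps `G` onto all selections, with a witness as preimage of each.
  many-clauses : 2 ^ m ≤ length G
  many-clauses = subst₂ _≤_ (length-selections m) (length-map selection G)
    (⊆-length (selections-unique m) λ {σ} _ → decoded σ)
    where
    selection : Clause → Vec Bool m
    selection C = tabulate λ i → elemL (neg (cause i)) C
    decoded : ∀ σ → σ ∈ map selection G
    decoded σ with witness σ
    ... | C , C∈G , w = subst (_∈ map selection G)
      (trans (tabulate-cong (selection-bit σ C∈G w)) (tabulate∘lookup σ)) (∈-map⁺ selection C∈G)

  -- No clause is empty, as each contains `neg guard`.
  exponential-size : 2 ^ m ≤ ℓ G
  exponential-size = ≤-trans many-clauses (bound (All.tabulate guard∈G))
    where
    bound : ∀ {H} → All (neg guard ∈_) H → length H ≤ ℓ H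
    bound []                     = z≤n
    bound {(_ ∷ C) ∷ _} (_ ∷ g∈) = s≤s (≤-trans (bound g∈) (m≤n+m _ (length C)))

-- Exponential against polynomial growth.

n<2^n : ∀ n → n < 2 ^ n
n<2^n zero    = s≤s z≤n
n<2^n (suc n) = begin
  suc (suc n)           ≤⟨ s≤s (n<2^n n) ⟩
  1 + 2 ^ n             ≤⟨ +-mono-≤ (m^n>0 2 n) (m≤m+n (2 ^ n) 0) ⟩
  2 ^ suc n             ∎
  where open ≤-Reasoning

double≡2* : ∀ m → double m ≡ 2 * m
double≡2* zero    = refl
double≡2* (suc m) = trans (cong (λ d → suc (suc d)) (double≡2* m)) (sym (*-suc 2 m))

-- For `m = 2 ^ t` the left side is at most a power of 2 whose exponent is linear in `t`, and `m`
-- itself is exponential in `t`.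
exponential-beats-polynomial : ∀ c k → ∃ λ m → c * suc (double m) ^ k + c < 2 ^ m
exponential-beats-polynomial c k = m , (begin
  suc (c * suc (double m) ^ k + c)    ≡⟨ +-suc _ c ⟨
  c * suc (double m) ^ k + suc c      ≤⟨ +-mono-≤ (*-mono-≤ (n≤1+n c) (^-monoˡ-≤ k base)) (m≤m*n (suc c) X) ⟩
  suc c * X + suc c * X               ≡⟨ cong (suc c * X +_) (+-identityʳ (suc c * X)) ⟨
  2 * (suc c * X)                     ≤⟨ *-monoʳ-≤ 2 (*-monoˡ-≤ X (n<2^n c)) ⟩
  2 * (2 ^ c * X)                     ≡⟨ *-assoc 2 (2 ^ c) X ⟨
  2 ^ suc c * X                       ≡⟨ cong (2 ^ suc c *_) (^-*-assoc 2 (2 + t) k) ⟩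
  2 ^ suc c * 2 ^ ((2 + t) * k)       ≡⟨ ^-distribˡ-+-* 2 (suc c) ((2 + t) * k) ⟨
  2 ^ (suc c + (2 + t) * k)           ≤⟨ ^-monoʳ-≤ 2 exponent ⟩
  2 ^ m                               ∎)
  where
  open ≤-Reasoning
  s t m X : ℕ
  -- Chosen so that the exponent is at most `suc s * suc s`; taking `t = s + s` makes `m` the square
  -- of `2 ^ s`, which exceeds `s`.
  s = suc (c + 2 * k)
  t = s + s
  m = 2 ^ t
  X = (2 ^ (2 + t)) ^ k
  instance
    X≢0 : NonZero X
    X≢0 = m^n≢0 (2 ^ (2 + t)) k {{m^n≢0 2 (2 + t)}}
  base : suc (double m) ≤ 2 ^ (2 + t)
  base = begin
    suc (double m)       ≡⟨ cong suc (double≡2* m) ⟩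
    1 + 2 * m            ≤⟨ +-monoˡ-≤ (2 * m) (≤-trans (m^n>0 2 t) (m≤m+n m (m + 0))) ⟩
    2 * m + 2 * m        ≡⟨ cong (2 * m +_) (+-identityʳ (2 * m)) ⟨
    2 ^ (2 + t)          ∎
  square : ∀ c k → suc c + (2 + (suc (c + 2 * k) + suc (c + 2 * k))) * k + (1 + suc (c + 2 * k) * (2 + c))
                   ≡ suc (suc (c + 2 * k)) * suc (suc (c + 2 * k))
  square = solve-∀
  exponent : suc c + (2 + t) * k ≤ m
  exponent = begin
    suc c + (2 + t) * k                        ≤⟨ m≤m+n _ (1 + s * (2 + c)) ⟩
    suc c + (2 + t) * k + (1 + s * (2 + c))    ≡⟨ square c k ⟩
    suc s * suc s                              ≤⟨ *-mono-≤ (n<2^n s) (n<2^n s) ⟩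
    2 ^ s * 2 ^ s                              ≡⟨ ^-distribˡ-+-* 2 s s ⟨
    m                                          ∎

-- The Turing machine

data Letter : Set where
  d0 d1 plus minus end : Letter

ι : Letter → Sym 4
ι d0    = b0
ι d1    = b1
ι plus  = sp
ι minus = sn
ι end   = sep

-- E replaces the input that has been read; b1′, sn′ and sp′ mark the letter to which the head returns
-- after it has written a word at the end of the tape.
pattern E   = extra 0F
pattern b1′ = extra 1F
pattern sn′ = extra 2F
pattern sp′ = extra 3F

-- From first to next the machine consumes the input, from head₀ to body₁ (and next) it copies the head and
-- the body atom of a short clause, and from scan to scanBody it copies the heads into the long clause.
data Phase : Set where
  init first next head₀ head₁ body₀ body₁ scan scanHead scanBody halt : Phase

data Word : Set where
  one plus minus closing closing₁ closing₂ : Word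

-- closing ends a clause with neg guard; closing₁ and closing₂ are what remains to be written of it.
spell : Word → List Letter
spell one      = d1 ∷ []
spell plus     = plus ∷ []
spell minus    = minus ∷ []
spell closing  = minus ∷ d0 ∷ end ∷ []
spell closing₁ = d0 ∷ end ∷ []
spell closing₂ = end ∷ []

data Mode : Set where
  read back : Mode
  write     : Word → Mode

State : Set
State = Mode × Phase

Action : Set
Action = Maybe State × Sym 4 × Move

go : Sym 4 → Phase → Action
go a p = just (read , p) , a , R

emit : Sym 4 → Word → Phase → Action
emit a w p = just (write w , p) , a , R

action : State → Sym 4 → Action
-- The first two input letters yield no digit, because the highest atom of `F n` has index `n - 2`.
action (read , init)       b1    = go E first
-- For input length 1 the only clause is `neg guard`.
action (read , first)      blank = just (write closing , halt) , blank , S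
action (read , first)      b1    = emit E plus next
action (read , next)       b1    = emit E one next
action (read , next)       b0    = go b0 next
action (read , next)       sep   = go sep next
action (read , next)       sp    = go sp head₀
-- An empty head block is atom 0, which has no body: this is the unpaired clause.
action (read , head₀)      blank = just (write closing , scan) , blank , S
-- The first digit of a block is traded for the sign of the next literal, which shortens the copy by
-- one digit; `body₀` does the same.
action (read , head₀)      b1    = emit b1′ minus head₁
action (read , head₁)      b1    = emit b1′ one head₁
action (read , head₁)      sn    = emit sn′ closing body₀
action (read , body₀)      b1    = emit b1′ plus body₁
-- The body was atom 0, so no further short clause follows.
action (read , body₀)      sn    = just (back , scan) , sn , S
action (read , body₁)      b1    = emit b1′ one body₁
action (read , body₁)      sn    = go sn next
action (read , scan)       sp    = emit sp′ minus scanHead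
-- Short clauses start with `sp`, so the long clause has been reached and lacks only its closing.
action (read , scan)       sn    = just (write closing , halt) , sn , S
action (read , scanHead)   b1    = emit b1′ one scanHead
action (read , scanHead)   sn    = go sn scanBody
action (read , scanBody)   b1    = go b1 scanBody
action (read , scanBody)   b0    = go b0 scanBody
action (read , scanBody)   sn    = go sn scanBody
action (read , scanBody)   sep   = go sep scan
-- Runs on actual inputs come here only in phase `halt`, or in `init` on the empty input.
action (read , _)          s     = nothing , s , S
action (back , p)          E     = go E p
action (back , p)          b1′   = go b1 p
action (back , p)          sn′   = go sn p
action (back , p)          sp′   = go sp p
action (back , p)          s     = just (back , p) , s , L
action (write one , p)     blank = just (back , p) , b1 , S
action (write plus , p)    blank = just (back , p) , sp , S
action (write minus , p)   blank = just (back , p) , sn , S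
action (write closing , p) blank = just (write closing₁ , p) , sn , R
action (write closing₁ , p) blank = just (write closing₂ , p) , b0 , R
action (write closing₂ , p) blank = just (back , p) , sep , S
action (write w , p)       s     = just (write w , p) , s , R

modes : Vec Mode 8
modes = read ∷ back ∷ write one ∷ write plus ∷ write minus ∷ write closing ∷ write closing₁ ∷ write closing₂ ∷ []

phases : Vec Phase 11
phases = init ∷ first ∷ next ∷ head₀ ∷ head₁ ∷ body₀ ∷ body₁ ∷ scan ∷ scanHead ∷ scanBody ∷ halt ∷ []

mode# : Mode → Fin 8
mode# read             = 0F
mode# back             = 1F
mode# (write one)      = 2F
mode# (write plus)     = 3F
mode# (write minus)    = 4F
mode# (write closing)  = 5F
mode# (write closing₁) = 6F
mode# (write closing₂) = 7F

phase# : Phase → Fin 11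
phase# init  = 0F
phase# first = 1F
phase# next  = 2F
phase# head₀    = 3F
phase# head₁    = 4F
phase# body₀    = 5F
phase# body₁    = 6F
phase# scan    = 7F
phase# scanHead     = 8F
phase# scanBody     = 9F
phase# halt  = suc 9F

lookup-mode# : ∀ m → lookup modes (mode# m) ≡ m
lookup-mode# read             = refl
lookup-mode# back             = refl
lookup-mode# (write one)      = refl
lookup-mode# (write plus)     = refl
lookup-mode# (write minus)    = refl
lookup-mode# (write closing)  = refl
lookup-mode# (write closing₁) = refl
lookup-mode# (write closing₂) = refl

lookup-phase# : ∀ p → lookup phases (phase# p) ≡ p
lookup-phase# init  = refl
lookup-phase# first = refl
lookup-phase# next  = refl
lookup-phase# head₀    = refl
lookup-phase# head₁    = refl
lookup-phase# body₀    = refl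
lookup-phase# body₁    = refl
lookup-phase# scan    = refl
lookup-phase# scanHead     = refl
lookup-phase# scanBody     = refl
lookup-phase# halt  = refl

code : State → Fin 88
code (m , p) = combine (mode# m) (phase# p)

lookup-remQuot-combine : ∀ {A B : Set} {m n} (xs : Vec A m) (ys : Vec B n) {i j x y} →
  lookup xs i ≡ x → lookup ys j ≡ y →
  let q = remQuot {m} n (combine i j) in (lookup xs (proj₁ q) , lookup ys (proj₂ q)) ≡ (x , y)
lookup-remQuot-combine xs ys {i} {j} refl refl =
  cong (λ q → lookup xs (proj₁ q) , lookup ys (proj₂ q)) (remQuot-combine i j)

-- Abstract, because remQuot at 88 states unfolds to a huge term.
abstract
  decode : Fin 88 → State
  decode q = lookup modes (proj₁ (remQuot {8} 11 q)) , lookup phases (proj₂ (remQuot {8} 11 q))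

  decode-code : ∀ s → decode (code s) ≡ s
  decode-code (m , p) =
    lookup-remQuot-combine modes phases {mode# m} {phase# p} (lookup-mode# m) (lookup-phase# p)

codeAction : Action → Maybe (Fin 88) × Sym 4 × Move
codeAction (s , a , d) = Maybe.map code s , a , d

-- The machine and its single steps.

M : TM
M = record { Q = 87 ; Γ = 4 ; δ = λ q a → codeAction (action (decode q) a) }

δ-code : ∀ s a → TM.δ M (code s) a ≡ codeAction (action s a)
δ-code s a = cong (λ s → codeAction (action s a)) (decode-code s)

-- Joins the head cell to the right part of the tape; the empty list means that the head is on a
-- blank past the end.
conf : Maybe State → List (Sym 4) → List (Sym 4) → Config M
conf s l []      = cfg (Maybe.map code s) l blank []
conf s l (a ∷ r) = cfg (Maybe.map code s) l a r

head : List (Sym 4) → Sym 4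
head []      = blank
head (a ∷ _) = a

tail : List (Sym 4) → List (Sym 4)
tail []      = []
tail (_ ∷ r) = r

module _ (N : TM) {q : Fin (suc (TM.Q N))} {h w : Sym (TM.Γ N)} {q′ : Maybe (Fin (suc (TM.Q N)))} where

  step-cfgR[] : ∀ l → TM.δ N q h ≡ (q′ , w , R) → step N (cfg (just q) l h []) ≡ cfg q′ (w ∷ l) blank []
  step-cfgR[] l eq rewrite eq = refl

  step-cfgR : ∀ l x r → TM.δ N q h ≡ (q′ , w , R) → step N (cfg (just q) l h (x ∷ r)) ≡ cfg q′ (w ∷ l) x r
  step-cfgR l x r eq rewrite eq = refl

  step-cfgL : ∀ l x r → TM.δ N q h ≡ (q′ , w , L) → step N (cfg (just q) (x ∷ l) h r) ≡ cfg q′ l x (w ∷ r)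
  step-cfgL l x r eq rewrite eq = refl

  step-cfgS : ∀ l r → TM.δ N q h ≡ (q′ , w , S) → step N (cfg (just q) l h r) ≡ cfg q′ l w r
  step-cfgS l r eq rewrite eq = refl

module _ {s : State} {s′ : Maybe State} {a : Sym 4} where

  private
    δ-eq : ∀ {h d} → action s h ≡ (s′ , a , d) → TM.δ M (code s) h ≡ (Maybe.map code s′ , a , d)
    δ-eq {h} eq = trans (δ-code s h) (cong codeAction eq)

  step-R : ∀ l u → action s (head u) ≡ (s′ , a , R) → step M (conf (just s) l u) ≡ conf s′ (a ∷ l) (tail u)
  step-R l []          eq = step-cfgR[] M l (δ-eq eq)
  step-R l (x ∷ [])    eq = step-cfgR[] M l (δ-eq eq)
  step-R l (x ∷ y ∷ u) eq = step-cfgR M l y u (δ-eq eq)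

  step-L : ∀ x l u → action s (head u) ≡ (s′ , a , L) → step M (conf (just s) (x ∷ l) u) ≡ conf s′ l (x ∷ a ∷ tail u)
  step-L x l []      eq = step-cfgL M l x [] (δ-eq eq)
  step-L x l (y ∷ u) eq = step-cfgL M l x u (δ-eq eq)

  step-S : ∀ l u → action s (head u) ≡ (s′ , a , S) → step M (conf (just s) l u) ≡ conf s′ l (a ∷ tail u)
  step-S l []      eq = step-cfgS M l [] (δ-eq eq)
  step-S l (y ∷ u) eq = step-cfgS M l u (δ-eq eq)

run-+ : ∀ N s t c → run N (s + t) c ≡ run N t (run N s c)
run-+ N zero    t c = refl
run-+ N (suc s) t c = run-+ N s t (step N c)

infixr 5 _⨾_
_⨾_ : ∀ {s t c c′ c″} → run M s c ≡ c′ → run M t c′ ≡ c″ → run M (s + t) c ≡ c″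
_⨾_ {s} {t} {c} p q = trans (run-+ M s t c) (trans (cong (run M t) p) q)

-- Appending a word and returning to a mark.

write-skip : ∀ w p x → action (write w , p) (ι x) ≡ (just (write w , p) , ι x , R)
write-skip one      p d0    = refl
write-skip one      p d1    = refl
write-skip one      p plus  = refl
write-skip one      p minus = refl
write-skip one      p end   = refl
write-skip plus     p d0    = refl
write-skip plus     p d1    = refl
write-skip plus     p plus  = refl
write-skip plus     p minus = refl
write-skip plus     p end   = refl
write-skip minus    p d0    = refl
write-skip minus    p d1    = refl
write-skip minus    p plus  = refl
write-skip minus    p minus = refl
write-skip minus    p end   = refl
write-skip closing  p d0    = refl
write-skip closing  p d1    = refl
write-skip closing  p plus  = refl
write-skip closing  p minus = refl
write-skip closing  p end   = refl
write-skip closing₁ p d0    = refl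
write-skip closing₁ p d1    = refl
write-skip closing₁ p plus  = refl
write-skip closing₁ p minus = refl
write-skip closing₁ p end   = refl
write-skip closing₂ p d0    = refl
write-skip closing₂ p d1    = refl
write-skip closing₂ p plus  = refl
write-skip closing₂ p minus = refl
write-skip closing₂ p end   = refl

back-skip : ∀ p x → action (back , p) (ι x) ≡ (just (back , p) , ι x , L)
back-skip p d0    = refl
back-skip p d1    = refl
back-skip p plus  = refl
back-skip p minus = refl
back-skip p end   = refl

module _ {p : Phase} where

  write-scan : ∀ w u l →
    run M (length u) (conf (just (write w , p)) l (map ι u)) ≡ conf (just (write w , p)) (map ι u ʳ++ l) []
  write-scan w []      l = refl
  write-scan w (x ∷ u) l =
    trans (cong (run M (length u)) (step-R l (ι x ∷ map ι u) (write-skip w p x))) (write-scan w u (ι x ∷ l))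

  -- The head stops on the last letter written, so the reversed word is split into that letter and
  -- the ones to its left.
  write-word : ∀ w l → Σ Letter λ a → Σ (List Letter) λ v →
      reverse (spell w) ≡ a ∷ v
    × run M (length (spell w)) (conf (just (write w , p)) l []) ≡ conf (just (back , p)) (map ι v ++ l) (ι a ∷ [])
  write-word one      l = d1 , [] , refl , step-S {s = write one , p} l [] refl
  write-word plus     l = plus , [] , refl , step-S {s = write plus , p} l [] refl
  write-word minus    l = minus , [] , refl , step-S {s = write minus , p} l [] refl
  write-word closing₂ l = end , [] , refl , step-S {s = write closing₂ , p} l [] refl
  write-word closing₁ l = end , d0 ∷ [] , refl ,
    _⨾_ {1} {1} (step-R {s = write closing₁ , p} l [] refl) (step-S {s = write closing₂ , p} (b0 ∷ l) [] refl)
  write-word closing  l = end , d0 ∷ minus ∷ [] , refl ,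
    _⨾_ {1} {2} (step-R {s = write closing , p} l [] refl)
      (_⨾_ {1} {1} (step-R {s = write closing₁ , p} (sn ∷ l) [] refl)
                   (step-S {s = write closing₂ , p} (b0 ∷ sn ∷ l) [] refl))

  back-scan : ∀ v x u m l →
    run M (suc (length v)) (conf (just (back , p)) (map ι v ++ m ∷ l) (ι x ∷ u))
      ≡ conf (just (back , p)) l (m ∷ (map ι (x ∷ v) ʳ++ u))
  back-scan []      x u m l = step-L m l (ι x ∷ u) (back-skip p x)
  back-scan (y ∷ v) x u m l =
    trans (cong (run M (suc (length v))) (step-L (ι y) (map ι v ++ m ∷ l) (ι x ∷ u) (back-skip p x)))
          (back-scan v y (ι x ∷ u) m l)

-- `E` restores to itself, a primed symbol to the letter it stands for.
Restores : Sym 4 → Sym 4 → Set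
Restores m s = ∀ p → action (back , p) m ≡ go s p

ʳ++-map-ι : ∀ u v l → map ι u ʳ++ (map ι v ++ l) ≡ map ι (u ʳ++ v) ++ l
ʳ++-map-ι []      v l = refl
ʳ++-map-ι (x ∷ u) v l = ʳ++-map-ι u (x ∷ v) l

reverse-++-ʳ++ : ∀ {A : Set} (w u v : List A) → reverse (reverse w ++ (u ʳ++ v)) ≡ v ʳ++ (u ++ w)
reverse-++-ʳ++ w u v = trans (++-ʳ++ (reverse w))
  (trans (ʳ++-ʳ++ u) (cong (λ z → v ʳ++ (u ++ z)) (reverse-involutive w)))

back-to-mark : ∀ {p m s} → Restores m s → ∀ v x u l →
  run M (suc (length v) + 1) (conf (just (back , p)) (map ι v ++ m ∷ l) (ι x ∷ map ι u))
    ≡ conf (just (read , p)) (s ∷ l) (map ι ((x ∷ v) ʳ++ u))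
back-to-mark {p} {m} r v x u l =
  _⨾_ {suc (length v)} {1} (back-scan v x (map ι u) m l)
    (trans (step-R l (m ∷ _) (r p)) (cong (conf (just (read , p)) _) (sym (map-ʳ++ ι (x ∷ v)))))

-- Right over `u` and along the new word, left over the word, `u` and `v`, and one step off the
-- mark.
sweep-time : Word → List Letter → List Letter → ℕ
sweep-time w v u = (length u + length (spell w)) + (length (spell w) + (length u + length v) + 1)

-- `v` lies between the mark and the head. It is empty when the mark has just been set, and consists
-- of all letters read in the pass when the head returns to the erased input.
sweep : ∀ w {p m s} → Restores m s → ∀ v u l →
  run M (sweep-time w v u) (conf (just (write w , p)) (map ι v ++ m ∷ l) (map ι u))
    ≡ conf (just (read , p)) (s ∷ l) (map ι (v ʳ++ (u ++ spell w)))
sweep w {p} {m} {s} r v u l with write-word {p} w (map ι (u ʳ++ v) ++ m ∷ l)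
... | a , w′ , eq , written =
  _⨾_ {length u + length (spell w)}
    (_⨾_ {length u}
      (trans (write-scan w u _) (cong (λ z → conf (just (write w , p)) z []) (ʳ++-map-ι u v (m ∷ l)))) written)
    (trans (cong₂ (λ t z → run M (t + 1) (conf (just (back , p)) z (ι a ∷ []))) len left)
      (trans (back-to-mark r (w′ ++ (u ʳ++ v)) a [] l)
             (cong (λ z → conf (just (read , p)) _ (map ι z)) right)))
  where
  len : length (spell w) + (length u + length v) ≡ suc (length (w′ ++ (u ʳ++ v)))
  len = begin
    length (spell w) + (length u + length v)         ≡⟨ cong₂ _+_ (length-reverse (spell w)) (length-ʳ++ u) ⟨
    length (reverse (spell w)) + length (u ʳ++ v)    ≡⟨ cong (λ z → length z + length (u ʳ++ v)) eq ⟩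
    suc (length w′ + length (u ʳ++ v))               ≡⟨ cong suc (length-++ w′) ⟨
    suc (length (w′ ++ (u ʳ++ v)))                   ∎
    where open ≡-Reasoning
  left : map ι w′ ++ (map ι (u ʳ++ v) ++ m ∷ l) ≡ map ι (w′ ++ (u ʳ++ v)) ++ m ∷ l
  left = trans (sym (++-assoc (map ι w′) _ _)) (cong (_++ m ∷ l) (sym (map-++ ι w′ _)))
  right : (a ∷ (w′ ++ (u ʳ++ v))) ʳ++ [] ≡ v ʳ++ (u ++ spell w)
  right = trans (cong (λ z → (z ++ (u ʳ++ v)) ʳ++ []) (sym eq)) (reverse-++-ʳ++ (spell w) u v)

-- The tape as a queue, and the cost of moves.

record Queue : Set where
  constructor ⟨_∣_∣_⟩
  field
    phase  : Phase
    behind : List (Sym 4)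
    ahead  : List Letter

open Queue

-- The machine between sweeps: letters are read off the front of `ahead`, and words are appended at
-- its end.
config : Queue → Config M
config ⟨ p ∣ l ∣ u ⟩ = conf (just (read , p)) l (map ι u)

size : Queue → ℕ
size ⟨ _ ∣ l ∣ u ⟩ = length l + length u

-- Bounds one round trip on a tape of size `z`.
κ : ℕ → ℕ
κ z = 2 * suc z

κ-mono : ∀ {y z} → y ≤ z → κ y ≤ κ z
κ-mono y≤z = *-monoʳ-≤ 2 (s≤s y≤z)

-- Each move of the reading head costs at most κ (size c′), because the tape never shrinks.
infix 4 _⇒_
record _⇒_ (c c′ : Queue) : Set where
  field
    time moves : ℕ
    runs       : run M time (config c) ≡ config c′
    advances   : moves + length (behind c) ≡ length (behind c′)
    grows      : size c ≤ size c′
    bounded    : time ≤ moves * κ (size c′)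

-- The head returns to the first letter after the erased input, possibly after appending a word.
record Jump (c c′ : Queue) : Set where
  field
    time    : ℕ
    runs    : run M time (config c) ≡ config c′
    grows   : size c ≤ size c′
    bounded : time ≤ κ (size c′)

relocate : ∀ {c c′} → c ≡ c′ → c ⇒ c′
relocate refl = record { time = 0 ; moves = 0 ; runs = refl ; advances = refl ; grows = ≤-refl ; bounded = z≤n }

done : ∀ {p l u u′} → u ≡ u′ → ⟨ p ∣ l ∣ u ⟩ ⇒ ⟨ p ∣ l ∣ u′ ⟩
done eq = relocate (cong ⟨ _ ∣ _ ∣_⟩ eq)

stay : ∀ {c} → Jump c c
stay = record { time = 0 ; runs = refl ; grows = ≤-refl ; bounded = z≤n }

infixr 5 _▹_
_▹_ : ∀ {c c′ c″} → c ⇒ c′ → c′ ⇒ c″ → c ⇒ c″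
_▹_ {c} {c′} {c″} A B = record
  { time     = A.time + B.time
  ; moves    = A.moves + B.moves
  ; runs     = _⨾_ {A.time} {B.time} A.runs B.runs
  ; advances = begin-equality
      A.moves + B.moves + length (behind c)    ≡⟨ cong (_+ length (behind c)) (+-comm A.moves B.moves) ⟩
      B.moves + A.moves + length (behind c)    ≡⟨ +-assoc B.moves A.moves _ ⟩
      B.moves + (A.moves + length (behind c))  ≡⟨ cong (B.moves +_) A.advances ⟩
      B.moves + length (behind c′)             ≡⟨ B.advances ⟩
      length (behind c″)                       ∎
  ; grows    = ≤-trans A.grows B.grows
  ; bounded  = begin
      A.time + B.time
        ≤⟨ +-mono-≤ (≤-trans A.bounded (*-monoʳ-≤ A.moves (κ-mono B.grows))) B.bounded ⟩
      A.moves * κ (size c″) + B.moves * κ (size c″)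
        ≡⟨ *-distribʳ-+ (κ (size c″)) A.moves B.moves ⟨
      (A.moves + B.moves) * κ (size c″) ∎
  }
  where
  open ≤-Reasoning
  module A = _⇒_ A
  module B = _⇒_ B

going : ∀ {p p′ s a} → action (read , p) (ι s) ≡ go a p′ → ∀ {l u} →
  ⟨ p ∣ l ∣ s ∷ u ⟩ ⇒ ⟨ p′ ∣ a ∷ l ∣ u ⟩
going {p} {s = s} eq {l} {u} = record
  { time = 1 ; moves = 1 ; runs = step-R l (map ι (s ∷ u)) eq ; advances = refl
  ; grows = ≤-reflexive (+-suc _ _) ; bounded = s≤s z≤n }

emitting : ∀ {p p′ s m r w} → action (read , p) (ι s) ≡ emit m w p′ → Restores m r → ∀ {l u} →
  ⟨ p ∣ l ∣ s ∷ u ⟩ ⇒ ⟨ p′ ∣ r ∷ l ∣ u ++ spell w ⟩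
emitting {p} {p′} {s} {m} {w = w} eq restore {l} {u} = record
  { time = suc (sweep-time w [] u) ; moves = 1
  ; runs = _⨾_ {1} {sweep-time w [] u} (step-R l (map ι (s ∷ u)) eq) (sweep w restore [] u l)
  ; advances = refl
  ; grows = begin
      length l + suc (length u)                           ≡⟨ +-suc (length l) (length u) ⟩
      suc (length l + length u)                           ≤⟨ s≤s (+-monoʳ-≤ (length l) (m≤m+n (length u) _)) ⟩
      suc (length l + (length u + length (spell w)))      ≡⟨ cong (λ z → suc (length l + z)) (length-++ u) ⟨
      suc (length l + length (u ++ spell w))              ∎
  ; bounded = begin
      suc (sweep-time w [] u)                             ≡⟨ arith (length u) (length (spell w)) ⟩
      κ (length u + length (spell w))                     ≡⟨ cong κ (length-++ u) ⟨
      κ (length (u ++ spell w))                           ≤⟨ κ-mono (m≤n+m _ (suc (length l))) ⟩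
      κ (suc (length l) + length (u ++ spell w))          ≡⟨ *-identityˡ _ ⟨
      1 * κ (suc (length l) + length (u ++ spell w))      ∎
  }
  where
  open ≤-Reasoning
  arith : ∀ a b → suc ((a + b) + (b + (a + 0) + 1)) ≡ 2 * suc (a + b)
  arith = solve-∀

module _ {l₀ : List (Sym 4)} where

  -- The letters read in the current pass, nearest first, down to the last erased cell, which serves
  -- as the mark to return to.
  lift : List Letter → List (Sym 4)
  lift v = map ι v ++ E ∷ l₀

  length-lift : ∀ v → length (lift v) ≡ length v + suc (length l₀)
  length-lift v = trans (length-++ (map ι v)) (cong (_+ suc (length l₀)) (length-map ι v))

  jump-writing : ∀ {p p′ w} v u → action (read , p) (head (map ι u)) ≡ (just (write w , p′) , head (map ι u) , S) →
    Jump ⟨ p ∣ lift v ∣ u ⟩ ⟨ p′ ∣ E ∷ l₀ ∣ v ʳ++ (u ++ spell w) ⟩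
  jump-writing {p} {p′} {w} v u eq = record
    { time = suc (sweep-time w v u)
    ; runs = _⨾_ {1} {sweep-time w v u} {config ⟨ p ∣ lift v ∣ u ⟩}
        (trans (step-S (lift v) (map ι u) eq) (restore u)) (sweep w (λ _ → refl) v u l₀)
    ; grows = begin
        length (lift v) + length u                              ≡⟨ cong (_+ length u) (length-lift v) ⟩
        length v + suc (length l₀) + length u                   ≤⟨ m≤m+n _ (length (spell w)) ⟩
        length v + suc (length l₀) + length u + length (spell w) ≡⟨ total ⟩
        suc (length l₀) + length (v ʳ++ (u ++ spell w))         ∎
    ; bounded = begin
        suc (sweep-time w v u)
          ≡⟨ arith (length u) (length (spell w)) (length v) ⟩
        2 * suc (length u + length (spell w)) + length v
          ≤⟨ arith′ (length u) (length (spell w)) (length v) (length l₀) ⟩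
        κ (length v + suc (length l₀) + length u + length (spell w))
          ≡⟨ cong κ total ⟩
        κ (suc (length l₀) + length (v ʳ++ (u ++ spell w))) ∎
    }
    where
    open ≤-Reasoning
    restore : ∀ u → conf (just (write w , p′)) (lift v) (head (map ι u) ∷ tail (map ι u))
      ≡ conf (just (write w , p′)) (lift v) (map ι u)
    restore []      = refl
    restore (_ ∷ _) = refl
    arith : ∀ a b c → suc ((a + b) + (b + (a + c) + 1)) ≡ 2 * suc (a + b) + c
    arith = solve-∀
    assoc : ∀ a b c d → a + suc b + c + d ≡ suc b + (a + (c + d))
    assoc = solve-∀
    arith′ : ∀ a b c d → 2 * suc (a + b) + c ≤ 2 * suc (c + suc d + a + b)
    arith′ a b c d = subst (2 * suc (a + b) + c ≤_) (lemma a b c d) (m≤m+n _ (c + 2 * suc d))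
      where
      lemma : ∀ a b c d → 2 * suc (a + b) + c + (c + 2 * suc d) ≡ 2 * suc (c + suc d + a + b)
      lemma = solve-∀
    total : length v + suc (length l₀) + length u + length (spell w) ≡ suc (length l₀) + length (v ʳ++ (u ++ spell w))
    total = begin-equality
      length v + suc (length l₀) + length u + length (spell w)   ≡⟨ assoc (length v) _ (length u) _ ⟩
      suc (length l₀) + (length v + (length u + length (spell w)))
        ≡⟨ cong (λ z → suc (length l₀) + (length v + z)) (length-++ u) ⟨
      suc (length l₀) + (length v + length (u ++ spell w))       ≡⟨ cong (suc (length l₀) +_) (length-ʳ++ v) ⟨
      suc (length l₀) + length (v ʳ++ (u ++ spell w))            ∎

  jump-back : ∀ {p p′} v x u → action (read , p) (ι x) ≡ (just (back , p′) , ι x , S) →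
    Jump ⟨ p ∣ lift v ∣ x ∷ u ⟩ ⟨ p′ ∣ E ∷ l₀ ∣ v ʳ++ (x ∷ u) ⟩
  jump-back {p} {p′} v x u eq = record
    { time = suc (suc (length v) + 1)
    ; runs = _⨾_ {1} {suc (length v) + 1} (step-S (lift v) (map ι (x ∷ u)) eq) (back-to-mark {m = E} (λ _ → refl) v x u l₀)
    ; grows = ≤-reflexive total
    ; bounded = begin
        suc (suc (length v) + 1)             ≤⟨ arith (length v) (length l₀) (length u) ⟩
        κ (length v + suc (length l₀) + suc (length u))  ≡⟨ cong (λ z → κ (z + suc (length u))) (length-lift v) ⟨
        κ (length (lift v) + suc (length u)) ≡⟨ cong κ total ⟩
        κ (suc (length l₀) + length (v ʳ++ (x ∷ u))) ∎
    }
    where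
    open ≤-Reasoning
    assoc : ∀ a b c → a + suc b + c ≡ suc b + (a + c)
    assoc = solve-∀
    arith : ∀ a b c → suc (suc a + 1) ≤ 2 * suc (a + suc b + suc c)
    arith a b c = subst (suc (suc a + 1) ≤_) (lemma a b c) (m≤m+n _ (a + 2 * b + 2 * c + 3))
      where
      lemma : ∀ a b c → suc (suc a + 1) + (a + 2 * b + 2 * c + 3) ≡ 2 * suc (a + suc b + suc c)
      lemma = solve-∀
    total : length (lift v) + suc (length u) ≡ suc (length l₀) + length (v ʳ++ (x ∷ u))
    total = trans (cong (_+ suc (length u)) (length-lift v))
      (trans (assoc (length v) (length l₀) (suc (length u))) (cong (suc (length l₀) +_) (sym (length-ʳ++ v))))

-- The two passes that write the clauses.

block : ℕ → List Letter
block k = replicate k d1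

shortWord : ℕ → List Letter
shortWord zero          = []
shortWord (suc zero)    = plus ∷ spell closing
shortWord (suc (suc j)) = plus ∷ block (suc j) ++ minus ∷ block j ++ spell closing ++ shortWord j

-- Omits the final `neg guard` and separator, which are written only when the scan is over.
longWord : ℕ → List Letter
longWord zero          = []
longWord (suc zero)    = minus ∷ []
longWord (suc (suc j)) = minus ∷ block (suc j) ++ longWord j

-- Every digit read is erased and written anew at the end, so the block moves behind `u`.
erase-input : ∀ k l u →
  ⟨ next ∣ E ∷ l ∣ block k ++ u ⟩ ⇒ ⟨ next ∣ E ∷ (replicate k E ʳ++ l) ∣ u ++ block k ⟩
erase-input zero    l u = done (sym (++-identityʳ u))
erase-input (suc k) l u =
  emitting {r = E} refl (λ _ → refl) ▹ done (++-assoc (block k) u _)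
  ▹ erase-input k (E ∷ l) (u ++ d1 ∷ []) ▹ done (++-assoc u _ _)

module _ {l₀ : List (Sym 4)} where

  private
    ↑_ : List Letter → List (Sym 4)
    ↑ v = lift {l₀} v
    infix 10 ↑_

  copy-block : ∀ {p} → action (read , p) b1 ≡ emit b1′ one p → ∀ k v u →
    ⟨ p ∣ ↑ v ∣ block k ++ u ⟩ ⇒ ⟨ p ∣ ↑ (block k ʳ++ v) ∣ u ++ block k ⟩
  copy-block eq zero    v u = done (sym (++-identityʳ u))
  copy-block eq (suc k) v u =
    emitting {r = b1} eq (λ _ → refl) ▹ done (++-assoc (block k) u _)
    ▹ copy-block eq k (d1 ∷ v) (u ++ d1 ∷ []) ▹ done (++-assoc u _ _)

  skip-block : ∀ k v u → ⟨ scanBody ∣ ↑ v ∣ block k ++ u ⟩ ⇒ ⟨ scanBody ∣ ↑ (block k ʳ++ v) ∣ u ⟩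
  skip-block zero    v u = done refl
  skip-block (suc k) v u = going refl ▹ skip-block k (d1 ∷ v) u

  -- Initially only the head of the first clause is unread. Each round reads a head and its body and
  -- appends that body, the closing and the next head, which is two digits shorter than the previous
  -- one.
  write-shorts : ∀ k v → ∃ λ c →
    ⟨ next ∣ ↑ v ∣ plus ∷ block k ⟩ ⇒ c × Jump c ⟨ scan ∣ E ∷ l₀ ∣ v ʳ++ shortWord (suc k) ⟩
  write-shorts zero v = ⟨ head₀ ∣ ↑ (plus ∷ v) ∣ [] ⟩ , going refl , jump-writing (plus ∷ v) [] refl
  write-shorts (suc zero) v =
    ⟨ body₀ ∣ ↑ (minus ∷ d1 ∷ plus ∷ v) ∣ spell closing ⟩
    , going refl ▹ emitting {r = b1} refl (λ _ → refl) ▹ emitting {r = sn} refl (λ _ → refl)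
    , jump-back (minus ∷ d1 ∷ plus ∷ v) minus (d0 ∷ end ∷ []) refl
  write-shorts (suc (suc k)) v with write-shorts k v′
    where
    v′ : List Letter
    v′ = end ∷ d0 ∷ minus ∷ (block k ʳ++ (d1 ∷ minus ∷ (block (suc k) ʳ++ (d1 ∷ plus ∷ v))))
  ... | c , reach , jump = c
    , going refl ▹ emitting {r = b1} refl (λ _ → refl)
      ▹ copy-block refl (suc k) (d1 ∷ plus ∷ v) (minus ∷ [])
      ▹ emitting {r = sn} refl (λ _ → refl) ▹ emitting {r = b1} refl (λ _ → refl)
      ▹ done (++-assoc (block k) (spell closing) (plus ∷ []))
      ▹ copy-block refl k (d1 ∷ minus ∷ _) (spell closing ++ plus ∷ [])
      -- The three letters of the closing are walked over, leaving only the next head.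
      ▹ going refl ▹ going refl ▹ going refl ▹ reach
    , subst (λ z → Jump c ⟨ scan ∣ E ∷ l₀ ∣ z ⟩)
        (trans (ʳ++-ʳ++ (block k)) (ʳ++-ʳ++ (block (suc k)))) jump

  -- The atoms of the long clause are the heads of the short ones. Each head is copied behind `x`
  -- with its sign reversed, and the bodies are skipped.
  write-long : ∀ j v x →
    ⟨ scan ∣ ↑ v ∣ shortWord j ++ x ⟩ ⇒ ⟨ scan ∣ ↑ (shortWord j ʳ++ v) ∣ x ++ longWord j ⟩
  write-long zero          v x = done (sym (++-identityʳ x))
  write-long (suc zero)    v x =
    emitting {r = sp} refl (λ _ → refl) ▹ going refl ▹ going refl ▹ going refl
  write-long (suc (suc j)) v x =
    emitting {r = sp} refl (λ _ → refl) ▹ done (assoc₃ (block (suc j)) _ x _)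
    ▹ copy-block refl (suc j) (plus ∷ v) _ ▹ going refl
    ▹ done (trans (cong (_++ block (suc j)) (assoc₃ (block j) _ x (minus ∷ []))) (++-assoc (block j) _ (block (suc j))))
    ▹ skip-block j _ _ ▹ going refl ▹ going refl ▹ going refl
    ▹ done (trans (++-assoc (shortWord j ++ x) (minus ∷ []) (block (suc j))) (++-assoc (shortWord j) x _))
    ▹ write-long j _ (x ++ minus ∷ block (suc j))
    ▹ relocate (cong₂ (λ v u → ⟨ scan ∣ ↑ v ∣ u ⟩)
        (sym (trans (++-ʳ++ (block (suc j))) (++-ʳ++ (block j)))) (++-assoc x _ _))
    where
    assoc₃ : ∀ (a b c d : List Letter) → ((a ++ b) ++ c) ++ d ≡ a ++ ((b ++ c) ++ d)
    assoc₃ a b c d = trans (cong (_++ d) (++-assoc a b c)) (++-assoc a (b ++ c) d)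

outputWord : ℕ → List Letter
outputWord j = shortWord j ++ longWord j ++ spell closing

finish : ∀ {l₀} j →
  Jump ⟨ scan ∣ lift {l₀} (shortWord (suc j) ʳ++ []) ∣ longWord (suc j) ⟩ ⟨ halt ∣ E ∷ l₀ ∣ outputWord (suc j) ⟩
finish {l₀} j =
  subst (λ z → Jump ⟨ scan ∣ lift (shortWord (suc j) ʳ++ []) ∣ longWord (suc j) ⟩ ⟨ halt ∣ E ∷ l₀ ∣ z ⟩)
    (ʳ++-ʳ++ (shortWord (suc j))) (jump-writing (shortWord (suc j) ʳ++ []) (longWord (suc j)) (at j))
  where
  at : ∀ j → action (read , scan) (head (map ι (longWord (suc j))))
           ≡ (just (write closing , halt) , head (map ι (longWord (suc j))) , S)
  at zero    = refl
  at (suc j) = refl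

-- A pass is a walk to the right and one jump back, charged with at most `suc (size c′)` round trips
-- on the final tape.
record Passes (k : ℕ) (c c′ : Queue) : Set where
  field
    time    : ℕ
    runs    : run M time (config c) ≡ config c′
    grows   : size c ≤ size c′
    bounded : time ≤ k * (suc (size c′) * κ (size c′))

passing : ∀ {c c′ c″} → c ⇒ c′ → Jump c′ c″ → Passes 1 c c″
passing {c} {c′} {c″} A J = record
  { time    = A.time + J.time
  ; runs    = _⨾_ {A.time} {J.time} A.runs J.runs
  ; grows   = ≤-trans A.grows J.grows
  ; bounded = begin
      A.time + J.time
        ≤⟨ +-mono-≤ A.bounded J.bounded ⟩
      A.moves * κ (size c′) + κ (size c″)
        ≤⟨ +-monoˡ-≤ (κ (size c″)) (*-mono-≤ moves≤ (κ-mono J.grows)) ⟩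
      size c″ * κ (size c″) + κ (size c″)
        ≡⟨ +-comm _ (κ (size c″)) ⟩
      suc (size c″) * κ (size c″)
        ≡⟨ *-identityˡ _ ⟨
      1 * (suc (size c″) * κ (size c″)) ∎
  }
  where
  open ≤-Reasoning
  module A = _⇒_ A
  module J = Jump J
  -- Every move leaves one more cell behind the head.
  moves≤ : A.moves ≤ size c″
  moves≤ = begin
    A.moves                          ≤⟨ m≤m+n _ _ ⟩
    A.moves + length (behind c)      ≡⟨ A.advances ⟩
    length (behind c′)               ≤⟨ m≤m+n _ _ ⟩
    size c′                          ≤⟨ J.grows ⟩
    size c″                          ∎

_⊕_ : ∀ {j k c c′ c″} → Passes j c c′ → Passes k c′ c″ → Passes (j + k) c c″
_⊕_ {j} {k} {c} {c′} {c″} A B = record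
  { time    = A.time + B.time
  ; runs    = _⨾_ {A.time} {B.time} A.runs B.runs
  ; grows   = ≤-trans A.grows B.grows
  ; bounded = begin
      A.time + B.time
        ≤⟨ +-mono-≤ (≤-trans A.bounded (*-monoʳ-≤ j (*-mono-≤ (s≤s B.grows) (κ-mono B.grows)))) B.bounded ⟩
      j * (suc (size c″) * κ (size c″)) + k * (suc (size c″) * κ (size c″))
        ≡⟨ *-distribʳ-+ _ j k ⟨
      (j + k) * (suc (size c″) * κ (size c″)) ∎
  }
  where
  open ≤-Reasoning
  module A = Passes A
  module B = Passes B

-- Has the form in which `erase-input` leaves the tape.
erased : ℕ → List (Sym 4)
erased zero    = []
erased (suc j) = replicate j E ʳ++ (E ∷ [])

computation : ∀ j → Passes 2 ⟨ init ∣ [] ∣ block (suc j) ⟩ ⟨ halt ∣ E ∷ erased j ∣ outputWord j ⟩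
-- Without short clauses the second pass is trivial.
computation zero    = passing (going refl) (jump-writing {l₀ = []} [] [] refl) ⊕ passing (done refl) stay
computation (suc j) with write-shorts {erased (suc j)} j []
... | c , reach , jump =
  passing (going refl ▹ emitting {r = E} refl (λ _ → refl) ▹ erase-input j (E ∷ []) (plus ∷ []) ▹ reach) jump
  ⊕ passing (done (sym (++-identityʳ _)) ▹ write-long (suc j) [] []) (finish j)

-- Word lengths and the running time.

length-shortWord : ∀ j → length (shortWord j) ≤ 4 * (j * suc j)
length-shortWord zero          = z≤n
length-shortWord (suc zero)    = s≤s (s≤s (s≤s (s≤s z≤n)))
length-shortWord (suc (suc j)) = begin
  suc (length (block (suc j) ++ minus ∷ block j ++ spell closing ++ shortWord j))
    ≡⟨ cong suc (trans (length-++ (block (suc j))) (cong₂ _+_ (length-replicate (suc j))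
        (cong suc (trans (length-++ (block j)) (cong (_+ (3 + length (shortWord j))) (length-replicate j)))))) ⟩
  suc (suc j + suc (j + (3 + length (shortWord j))))
    ≤⟨ s≤s (+-monoʳ-≤ (suc j) (s≤s (+-monoʳ-≤ j (+-monoʳ-≤ 3 (length-shortWord j))))) ⟩
  suc (suc j + suc (j + (3 + 4 * (j * suc j))))
    -- The exact difference of the two sides, which reduces the estimate to a polynomial identity;
    -- the bounds below proceed likewise.
    ≤⟨ m≤m+n _ (14 * j + 18) ⟩
  suc (suc j + suc (j + (3 + 4 * (j * suc j)))) + (14 * j + 18)
    ≡⟨ arith j ⟩
  4 * (suc (suc j) * suc (suc (suc j))) ∎
  where
  open ≤-Reasoning
  arith : ∀ j → suc (suc j + suc (j + (3 + 4 * (j * suc j)))) + (14 * j + 18) ≡ 4 * (suc (suc j) * suc (suc (suc j)))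
  arith = solve-∀

length-longWord : ∀ j → length (longWord j) ≤ j * suc j
length-longWord zero          = z≤n
length-longWord (suc zero)    = s≤s z≤n
length-longWord (suc (suc j)) = begin
  suc (length (block (suc j) ++ longWord j))
    ≡⟨ cong suc (trans (length-++ (block (suc j))) (cong (_+ length (longWord j)) (length-replicate (suc j)))) ⟩
  suc (suc j + length (longWord j))
    ≤⟨ s≤s (+-monoʳ-≤ (suc j) (length-longWord j)) ⟩
  suc (suc j + j * suc j)
    ≤⟨ m≤m+n _ (3 * j + 4) ⟩
  suc (suc j + j * suc j) + (3 * j + 4)
    ≡⟨ arith j ⟩
  suc (suc j) * suc (suc (suc j)) ∎
  where
  open ≤-Reasoning
  arith : ∀ j → suc (suc j + j * suc j) + (3 * j + 4) ≡ suc (suc j) * suc (suc (suc j))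
  arith = solve-∀

length-erased : ∀ j → length (erased j) ≡ j
length-erased zero    = refl
length-erased (suc j) = trans (length-ʳ++ (replicate j E) {E ∷ []}) (trans (cong (_+ 1) (length-replicate j)) (+-comm j 1))

final-size : ∀ j → size ⟨ halt ∣ E ∷ erased j ∣ outputWord j ⟩ ≤ 9 * (suc j * suc j)
final-size j = begin
  suc (length (erased j)) + length (outputWord j)
    ≡⟨ cong₂ _+_ (cong suc (length-erased j))
        (trans (length-++ (shortWord j)) (cong (length (shortWord j) +_) (length-++ (longWord j)))) ⟩
  suc j + (length (shortWord j) + (length (longWord j) + 3))
    ≤⟨ +-monoʳ-≤ (suc j) (+-mono-≤ (length-shortWord j) (+-monoˡ-≤ 3 (length-longWord j))) ⟩
  suc j + (4 * (j * suc j) + (j * suc j + 3))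
    ≤⟨ m≤m+n _ (4 * (j * j) + 12 * j + 5) ⟩
  suc j + (4 * (j * suc j) + (j * suc j + 3)) + (4 * (j * j) + 12 * j + 5)
    ≡⟨ arith j ⟩
  9 * (suc j * suc j) ∎
  where
  open ≤-Reasoning
  arith : ∀ j → suc j + (4 * (j * suc j) + (j * suc j + 3)) + (4 * (j * j) + 12 * j + 5) ≡ 9 * (suc j * suc j)
  arith = solve-∀

run-halted : ∀ t l h r → run M t (cfg nothing l h r) ≡ cfg nothing l h r
run-halted zero    l h r = refl
run-halted (suc t) l h r = run-halted t l h r

takeNonBlank-ι : ∀ u → takeNonBlank (map ι u) ≡ map ι u
takeNonBlank-ι []          = refl
takeNonBlank-ι (d0 ∷ u)    = cong (b0 ∷_) (takeNonBlank-ι u)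
takeNonBlank-ι (d1 ∷ u)    = cong (b1 ∷_) (takeNonBlank-ι u)
takeNonBlank-ι (plus ∷ u)  = cong (sp ∷_) (takeNonBlank-ι u)
takeNonBlank-ι (minus ∷ u) = cong (sn ∷_) (takeNonBlank-ι u)
takeNonBlank-ι (end ∷ u)   = cong (sep ∷_) (takeNonBlank-ι u)

halting : ∀ x → action (read , halt) (ι x) ≡ (nothing , ι x , S)
halting d0    = refl
halting d1    = refl
halting plus  = refl
halting minus = refl
halting end   = refl

halt-output : ∀ l u → let c = run M 1 (config ⟨ halt ∣ l ∣ u ⟩) in
  Config.state c ≡ nothing × output M c ≡ map ι u
halt-output l []      rewrite step-S {read , halt} l [] refl = refl , refl
halt-output l (x ∷ u) rewrite step-S {read , halt} l (map ι (x ∷ u)) (halting x) = refl , takeNonBlank-ι (x ∷ u)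

module _ {s : ℕ} {c : Config M} {w : List (Sym 4)} where
  -- A halted configuration no longer changes, so the exact running time may be replaced by any
  -- bound.
  later : ∀ {t} → s ≤ t → Config.state (run M s c) ≡ nothing × output M (run M s c) ≡ w →
    Config.state (run M t c) ≡ nothing × output M (run M t c) ≡ w
  later {t} s≤t (halted , out) with run M s c in eq
  ... | cfg nothing l h r = subst (λ c′ → Config.state c′ ≡ nothing × output M c′ ≡ w) (sym same) (refl , out)
    where
    same : run M t c ≡ cfg nothing l h r
    same = begin
      run M t c                       ≡⟨ cong (λ t → run M t c) (m+[n∸m]≡n s≤t) ⟨
      run M (s + (t ∸ s)) c           ≡⟨ run-+ M s (t ∸ s) c ⟩
      run M (t ∸ s) (run M s c)       ≡⟨ cong (run M (t ∸ s)) eq ⟩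
      run M (t ∸ s) (cfg nothing l h r) ≡⟨ run-halted (t ∸ s) l h r ⟩
      cfg nothing l h r               ∎
      where open ≡-Reasoning

computes-suc : ∀ j → ComputesWithin M (suc j) (401 * suc j ^ 4 + 401) (map ι (outputWord j))
computes-suc j = later {s = P.time + 1} time≤
  (subst (λ c → Config.state c ≡ nothing × output M c ≡ map ι (outputWord j)) (sym reached)
    (halt-output (E ∷ erased j) (outputWord j)))
  where
  module P = Passes (computation j)
  start : initial M (suc j) ≡ config ⟨ init ∣ [] ∣ block (suc j) ⟩
  start = cong (cfg (just zero) [] b1) (sym (map-replicate ι j d1))
  reached : run M (P.time + 1) (initial M (suc j)) ≡ run M 1 (config ⟨ halt ∣ E ∷ erased j ∣ outputWord j ⟩)
  reached = trans (run-+ M P.time 1 (initial M (suc j))) (cong (run M 1) (trans (cong (run M P.time) start) P.runs))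
  n = suc j
  z = size ⟨ halt ∣ E ∷ erased j ∣ outputWord j ⟩
  open ≤-Reasoning
  -- Gives two passes of at most `10 * (n * n)` round trips with at most `20 * (n * n)` steps each,
  -- to which the halting step is added.
  suc-z≤ : suc z ≤ 10 * (n * n)
  suc-z≤ = begin
    suc z                    ≤⟨ s≤s (final-size j) ⟩
    1 + 9 * (n * n)          ≤⟨ +-monoˡ-≤ (9 * (n * n)) (s≤s z≤n) ⟩
    n * n + 9 * (n * n)      ∎
  arith : ∀ n → 2 * (10 * (n * n) * (2 * (10 * (n * n)))) ≡ 400 * (n * (n * (n * (n * 1))))
  arith = solve-∀
  time≤ : P.time + 1 ≤ 401 * n ^ 4 + 401
  time≤ = begin
    P.time + 1                                       ≤⟨ +-monoˡ-≤ 1 P.bounded ⟩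
    2 * (suc z * κ z) + 1                            ≤⟨ +-monoˡ-≤ 1 (*-monoʳ-≤ 2 (*-mono-≤ suc-z≤ (*-monoʳ-≤ 2 suc-z≤))) ⟩
    2 * (10 * (n * n) * (2 * (10 * (n * n)))) + 1    ≡⟨ cong (_+ 1) (arith n) ⟩
    400 * n ^ 4 + 1                                  ≤⟨ +-mono-≤ (*-monoˡ-≤ (n ^ 4) (n≤1+n 400)) (s≤s z≤n) ⟩
    401 * n ^ 4 + 401                                ∎

computes-zero : ∀ t → ComputesWithin M 0 (suc t) []
computes-zero t = later {s = 1} {c = initial M 0} {t = suc t} (s≤s z≤n)
  (cong Config.state first-step , cong (output M) first-step)
  where
  first-step : run M 1 (initial M 0) ≡ cfg nothing [] blank []
  first-step = step-S {read , init} [] [] refl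

-- The encoding of the clause-sets.

atomᵇ : ℕ → ℕᵇ
atomᵇ zero    = zero
atomᵇ (suc k) = 2[1+ atomᵇ k ]

toℕ-atomᵇ : ∀ k → toℕ (atomᵇ k) ≡ atom k
toℕ-atomᵇ zero    = refl
toℕ-atomᵇ (suc k) = cong (λ m → 2 * suc m) (toℕ-atomᵇ k)

-- The numeral of `k` digits 2 is written down directly, and `fromℕ` recovers it from its value.
encode-atom : ∀ k → encℕᵇ (fromℕ (atom k)) ≡ map ι (block k)
encode-atom k = trans (cong encℕᵇ (trans (cong fromℕ (sym (toℕ-atomᵇ k))) (fromℕ-toℕ (atomᵇ k)))) (digits k)
  where
  digits : ∀ k → encℕᵇ (atomᵇ k) ≡ map ι (block k)
  digits zero    = refl
  digits (suc k) = cong (b1 ∷_) (digits k)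

encode-shorts : ∀ j → encClauseSet (shorts j) ≡ map ι (shortWord j)
encode-shorts zero          = refl
encode-shorts (suc zero)    = refl
encode-shorts (suc (suc j)) = begin
  ((sp ∷ enc (suc j)) ++ (sn ∷ enc j) ++ map ι (spell closing)) ++ encClauseSet (shorts j)
    ≡⟨ cong₂ _++_ (cong₂ (λ a b → (sp ∷ a) ++ (sn ∷ b) ++ map ι (spell closing))
        (encode-atom (suc j)) (encode-atom j)) (encode-shorts j) ⟩
  ((sp ∷ blk (suc j)) ++ (sn ∷ blk j) ++ map ι (spell closing)) ++ map ι (shortWord j)
    ≡⟨ cong (sp ∷_) (trans (++-assoc (blk (suc j)) _ _) (cong (λ w → blk (suc j) ++ sn ∷ w) (++-assoc (blk j) _ _))) ⟩
  sp ∷ blk (suc j) ++ sn ∷ blk j ++ map ι (spell closing ++ shortWord j)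
    ≡⟨ cong (λ w → sp ∷ blk (suc j) ++ sn ∷ w) (map-++ ι (block j) _) ⟨
  sp ∷ blk (suc j) ++ map ι (minus ∷ block j ++ spell closing ++ shortWord j)
    ≡⟨ cong (sp ∷_) (map-++ ι (block (suc j)) _) ⟨
  map ι (shortWord (suc (suc j))) ∎
  where
  open ≡-Reasoning
  enc blk : ℕ → List (Sym 4)
  enc k = encℕᵇ (fromℕ (atom k))
  blk k = map ι (block k)

encode-long : ∀ j → encClause (long j) ≡ map ι (longWord j ++ spell closing)
encode-long zero          = refl
encode-long (suc zero)    = refl
encode-long (suc (suc j)) = cong (sn ∷_) (begin
  encℕᵇ (fromℕ (atom (suc j))) ++ encClause (long j)
    ≡⟨ cong₂ _++_ (encode-atom (suc j)) (encode-long j) ⟩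
  map ι (block (suc j)) ++ map ι (longWord j ++ spell closing)
    ≡⟨ map-++ ι (block (suc j)) _ ⟨
  map ι (block (suc j) ++ longWord j ++ spell closing)
    ≡⟨ cong (map ι) (++-assoc (block (suc j)) (longWord j) _) ⟨
  map ι ((block (suc j) ++ longWord j) ++ spell closing) ∎)
  where open ≡-Reasoning

encode-F : ∀ j → encClauseSet (F (suc j)) ≡ map ι (outputWord j)
encode-F j = begin
  encClauseSet (shorts j ++ long j ∷ [])
    ≡⟨ concatMap-++ encClause (shorts j) (long j ∷ []) ⟩
  encClauseSet (shorts j) ++ (encClause (long j) ++ [])
    ≡⟨ cong₂ _++_ (encode-shorts j) (trans (++-identityʳ _) (encode-long j)) ⟩
  map ι (shortWord j) ++ map ι (longWord j ++ spell closing)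
    ≡⟨ map-++ ι (shortWord j) _ ⟨
  map ι (outputWord j) ∎
  where open ≡-Reasoning

F-computable : PolyTimeComputable F
F-computable = M , 401 , 4 , computes
  where
  computes : ∀ n → ComputesWithin M n (401 * n ^ 4 + 401) (encClauseSet (F n))
  -- The bound at 0 evaluates to 401, the successor of 400.
  computes zero    = computes-zero 400
  computes (suc j) = subst (ComputesWithin M (suc j) (401 * suc j ^ 4 + 401)) (sym (encode-F j)) (computes-suc j)

theorem8p1 : Σ (ℕ → ClauseSet) λ F →
    (∀ n → WFClauseSet (F n) × UC (F n) × nvars (F n) ≡ n)
    × PolyTimeComputable F
    × ¬ (Σ (ℕ → ClauseSet) λ F′ →
    (∀ n → WFClauseSet (F′ n) × PC (F′ n) × Equivalent (F′ n) (F n))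
    × PolyBounded (λ n → ℓ (F′ n)))
theorem8p1 = F , (λ n → F-WF n , Horn⇒UC (F-Horn n) , F-nvars n) , F-computable , no-PC
  where
  no-PC : ¬ (Σ (ℕ → ClauseSet) λ F′ →
    (∀ n → WFClauseSet (F′ n) × PC (F′ n) × Equivalent (F′ n) (F n)) × PolyBounded (λ n → ℓ (F′ n)))
  no-PC (F′ , F′-PC , c , k , bound) with exponential-beats-polynomial c k
  -- The odd indices, where all atoms are paired, already exceed any polynomial bound.
  ... | m , beats with F′-PC (suc (double m))
  ...   | _ , pc , equivalent =
    <-irrefl refl (≤-trans beats (≤-trans
      (exponential-size {m} (F′ (suc (double m))) pc equivalent) (bound (suc (double m)))))
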